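{- Let $k\ge 1$. For every $\epsilon>0$ there is $\eta>0$ such that for all sufficiently large $n$ the following holds. If $H$ is a $2k$-uniform hypergraph on $n$ vertices containing no copy of ${\cal C}^{(2k)}_3$ with $e(H)>\frac12\binom{n}{2k}-\eta n^{2k}$, then there is a partition $V(H)=V_1\cup V_2$ such that all but at most $\epsilon n^{2k}$ of the $2k$-element subsets of $V(H)$ are correct with respect to this partition.
   Context: ${\cal C}^{(2k)}_3$ is the $2k$-uniform hypergraph obtained by taking pairwise disjoint sets $P_1,P_2,P_3$ each of size $k$ with edges $P_1\cup P_2$, $P_2\cup P_3$, $P_3\cup P_1$. Given a partition $V(H)=V_1\cup V_2$, a $2k$-set is good if it intersects each $V_i$ in an odd number of elements, and bad otherwise; it is correct (with respect to $H$) if it is either a good edge of $H$ or a bad non-edge of $H$, and incorrect otherwise. -}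

module Defs where

open import Data.Fin.Subset using (Subset; inside; outside; Empty; ∣_∣; _∩_; _∪_; ⊤)
open import Data.Integer using (+_)
open import Data.List using (List; []; _∷_; _++_; map; filter; length)
open import Data.Nat using (ℕ; zero; suc; _*_; parity; _≟_)
open import Data.Parity using (1ℙ)
open import Data.Parity.Properties using () renaming (_≟_ to _≟ᴾ_)
open import Data.Product using (_×_)
open import Data.Rational using (ℚ; _/_)
open import Data.Sum using (_⊎_)
open import Data.Vec using ([]; _∷_)
open import Level using (0ℓ)
open import Relation.Binary.PropositionalEquality using (_≡_)
open import Relation.Nullary using (¬_; _×-dec_; _⊎-dec_; ¬?)
open import Relation.Unary using (Pred; Decidable)

fromℕ : ℕ → ℚ
fromℕ m = + m / 1

Odd : ℕ → Set
Odd m = parity m ≡ 1ℙ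

odd? : Decidable Odd
odd? m = parity m ≟ᴾ 1ℙ

-- Lists each subset of Fin n exactly once.
subsets : ∀ n → List (Subset n)
subsets zero    = [] ∷ []
subsets (suc n) = map (inside ∷_) (subsets n) ++ map (outside ∷_) (subsets n)

#subsets : ∀ {n} {P : Pred (Subset n) 0ℓ} → Decidable P → ℕ
#subsets {n} P? = length (filter P? (subsets n))

-- r-uniform hypergraphs with vertex set Fin n.
record Hypergraph (r n : ℕ) : Set₁ where
  field
    Edge    : Pred (Subset n) 0ℓ
    edge?   : Decidable Edge
    uniform : ∀ {S} → Edge S → ∣ S ∣ ≡ r

  e : ℕ
  e = #subsets edge?

open Hypergraph public

-- A copy is not required to be induced: H may have further edges inside
-- P₁ ∪ P₂ ∪ P₃.
record CopyOf𝒞₃ (k : ℕ) {n : ℕ} (H : Hypergraph (2 * k) n) : Set where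
  field
    P₁ P₂ P₃ : Subset n
    size₁    : ∣ P₁ ∣ ≡ k
    size₂    : ∣ P₂ ∣ ≡ k
    size₃    : ∣ P₃ ∣ ≡ k
    disj₁₂   : Empty (P₁ ∩ P₂)
    disj₂₃   : Empty (P₂ ∩ P₃)
    disj₃₁   : Empty (P₃ ∩ P₁)
    edge₁₂   : Edge H (P₁ ∪ P₂)
    edge₂₃   : Edge H (P₂ ∪ P₃)
    edge₃₁   : Edge H (P₃ ∪ P₁)

-- The parts may be empty.
IsPartition : ∀ {n} → Subset n → Subset n → Set
IsPartition V₁ V₂ = Empty (V₁ ∩ V₂) × V₁ ∪ V₂ ≡ ⊤

module _ {n : ℕ} (V₁ V₂ : Subset n) where

  Good : Pred (Subset n) 0ℓ
  Good S = Odd ∣ S ∩ V₁ ∣ × Odd ∣ S ∩ V₂ ∣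

  good? : Decidable Good
  good? S = odd? ∣ S ∩ V₁ ∣ ×-dec odd? ∣ S ∩ V₂ ∣

  Bad : Pred (Subset n) 0ℓ
  Bad S = ¬ Good S

  module _ {r : ℕ} (H : Hypergraph r n) where

    Correct : Pred (Subset n) 0ℓ
    Correct S = (Good S × Edge H S) ⊎ (Bad S × ¬ Edge H S)

    correct? : Decidable Correct
    correct? S = (good? S ×-dec edge? H S) ⊎-dec (¬? (good? S) ×-dec ¬? (edge? H S))

    -- Correctness is a notion for sets of the uniformity r only, hence the
    -- size condition.
    Incorrect : Pred (Subset n) 0ℓ
    Incorrect S = ∣ S ∣ ≡ r × ¬ Correct S

    incorrect? : Decidable Incorrect
    incorrect? S = (∣ S ∣ ≟ r) ×-dec ¬? (correct? S)

    #incorrect : ℕ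
    #incorrect = #subsets incorrect?

{-# OPTIONS --safe #-}

-- Count ordered k-tuples instead of k-sets. Joining two tuples when the union
-- of their supports is an edge of H gives a triangle-free graph G of density
-- almost 1/2. Averaging deg u + deg w over the edges u w of G yields an edge
-- whose two neighbourhoods, which are disjoint and independent, cover almost
-- everything, so with f(p) = [p u ∈ G] we have, over 𝔽₂,
-- [p ∪ q ∈ H] = f(p) + f(q) for almost all pairs p, q.
--
-- Exchanging elements between the two halves shows that f(x v) - f(a v) hardly
-- depends on v, whence f(v) = c + Σ_{x ∈ v} g(x) almost always. The constants
-- cancel, so [S ∈ H] = Σ_{x ∈ S} g(x) for almost all S: take V₁ = {g = 1}. Each
-- step multiplies the number of exceptions by a constant, and parameters are
-- fixed so as to do at least as well as the average.

module Submission where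

open import Defs

module Counting where

  open import Data.Bool using (Bool; true; false; not; _∧_; _∨_; _xor_; if_then_else_)
  open import Data.Bool.Properties using (not-distribˡ-xor; xor-assoc; xor-identityʳ; xor-same)
  open import Data.Bool.Solver using (module xor-∧-Solver)
  open import Data.Empty using (⊥; ⊥-elim)
  open import Data.Fin using (Fin; zero; suc; fromℕ<)
  open import Data.Fin.Subset using (Subset; Empty; ∣_∣; ⁅_⁆; _∪_; _∩_; ⊤; ∁) renaming (⊥ to ∅)
  open import Data.Fin.Subset.Properties
    using ( ∪-assoc; ∪-comm; ∪-identityˡ; ∩-identityʳ; ∣⊥∣≡0; ∣p∩q∣≤∣p∣; x∈p⇒∣p-x∣<∣p∣
          ; p∪∁p≡⊤; x∈p∩q⁻; x∈∁p⇒x∉p )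
  open import Data.List using (List; []; _∷_; _++_; map; filter; length; concatMap; allFin)
  open import Data.List.Properties using (length-tabulate; map-tabulate)
  open import Data.Nat
  open import Data.Nat.Combinatorics
    using (_C_; nCk≡n!/k![n-k]!; k>n⇒nCk≡0; k![n∸k]!∣n!; [n-k]*[n-k-1]!≡[n-k]!)
  open import Data.Nat.DivMod using (m/n*n≡m)
  open import Data.Nat.Properties
  open import Data.Nat.Tactic.RingSolver using (solve-∀)
  open import Data.Parity using (0ℙ; 1ℙ)
  open import Data.Parity.Properties using (suc-homo-⁻¹)
  open import Data.Product using (_×_; _,_; ∃-syntax; proj₁; proj₂)
  open import Data.Sum using (inj₁; inj₂)
  open import Data.Vec as Vec using (Vec; []; _∷_; lookup)
  open import Data.Vec.Properties using (lookup∘tabulate; lookup-replicate)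
  open import Function using (_∘_; const; id)
  open import Relation.Binary.PropositionalEquality
  open import Relation.Nullary using (Dec; yes; no; does; ¬_)
  open import Relation.Nullary.Decidable using (dec-true; dec-false)
  open import Relation.Unary using (Pred; Decidable)

  -- Finite sums over lists, averaging, and tuples.

  module _ {A : Set} where

    ∑ : List A → (A → ℕ) → ℕ
    ∑ []       f = 0
    ∑ (x ∷ xs) f = f x + ∑ xs f

    infixr 8 ∑
    syntax ∑ xs (λ x → e) = ∑[ x ∈ xs ] e

    ∑-cong : ∀ xs {f g : A → ℕ} → (∀ x → f x ≡ g x) → ∑ xs f ≡ ∑ xs g
    ∑-cong []       f≗g = refl
    ∑-cong (x ∷ xs) f≗g = cong₂ _+_ (f≗g x) (∑-cong xs f≗g)

    ∑-mono : ∀ xs {f g : A → ℕ} → (∀ x → f x ≤ g x) → ∑ xs f ≤ ∑ xs g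
    ∑-mono []       f≤g = z≤n
    ∑-mono (x ∷ xs) f≤g = +-mono-≤ (f≤g x) (∑-mono xs f≤g)

    ∑-+ : ∀ xs (f g : A → ℕ) → ∑[ x ∈ xs ] (f x + g x) ≡ ∑ xs f + ∑ xs g
    ∑-+ []       f g = refl
    ∑-+ (x ∷ xs) f g = trans (cong (f x + g x +_) (∑-+ xs f g)) (interchange (f x) (g x) _ _)
      where
      interchange : ∀ a b c d → a + b + (c + d) ≡ a + c + (b + d)
      interchange = solve-∀

    ∑-*ˡ : ∀ xs c (f : A → ℕ) → ∑[ x ∈ xs ] (c * f x) ≡ c * ∑ xs f
    ∑-*ˡ []       c f = sym (*-zeroʳ c)
    ∑-*ˡ (x ∷ xs) c f = trans (cong (c * f x +_) (∑-*ˡ xs c f)) (sym (*-distribˡ-+ c _ _))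

    ∑-*ʳ : ∀ xs c (f : A → ℕ) → ∑[ x ∈ xs ] (f x * c) ≡ ∑ xs f * c
    ∑-*ʳ xs c f = trans (∑-cong xs λ x → *-comm (f x) c) (trans (∑-*ˡ xs c f) (*-comm c _))

    ∑-const : ∀ xs c → ∑[ _ ∈ xs ] c ≡ length xs * c
    ∑-const []       c = refl
    ∑-const (x ∷ xs) c = cong (c +_) (∑-const xs c)

    ∑-++ : ∀ xs ys (f : A → ℕ) → ∑ (xs ++ ys) f ≡ ∑ xs f + ∑ ys f
    ∑-++ []       ys f = refl
    ∑-++ (x ∷ xs) ys f = trans (cong (f x +_) (∑-++ xs ys f)) (sym (+-assoc (f x) _ _))

    ∑-pick : ∀ xs {f g : A → ℕ} → ∑ xs f < ∑ xs g → ∃[ x ] f x < g x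
    ∑-pick (x ∷ xs) {f} {g} ∑f<∑g with f x <? g x
    ... | yes fx<gx = x , fx<gx
    ... | no  fx≮gx = ∑-pick xs (≰⇒> λ ∑g≤∑f → <⇒≱ ∑f<∑g (+-mono-≤ (≮⇒≥ fx≮gx) ∑g≤∑f))

    ∑-average : ∀ xs {f : A → ℕ} {b} → 0 < length xs → ∑ xs f ≤ b → ∃[ x ] length xs * f x ≤ b
    ∑-average xs {f} {b} 0<∣xs∣ ∑f≤b = let x , lt = ∑-pick xs strict in x , ≤-pred lt
      where
      -- `∑-pick` asks for a strict inequality, so the bound is raised to `suc b`; the nonzero
      -- factor `length xs` makes the comparison strict, and `≤-pred` removes the 1 again.
      strict : ∑[ x ∈ xs ] (length xs * f x) < ∑[ _ ∈ xs ] suc b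
      strict = begin-strict
        ∑[ x ∈ xs ] (length xs * f x) ≡⟨ ∑-*ˡ xs (length xs) f ⟩
        length xs * ∑ xs f            ≤⟨ *-monoʳ-≤ (length xs) ∑f≤b ⟩
        length xs * b                 <⟨ *-monoʳ-< (length xs) ⦃ >-nonZero 0<∣xs∣ ⦄ ≤-refl ⟩
        length xs * suc b             ≡⟨ ∑-const xs (suc b) ⟨
        ∑[ _ ∈ xs ] suc b             ∎
        where open ≤-Reasoning

  module _ {A B : Set} where

    ∑-map : ∀ (h : A → B) xs (f : B → ℕ) → ∑ (map h xs) f ≡ ∑ xs (f ∘ h)
    ∑-map h []       f = refl
    ∑-map h (x ∷ xs) f = cong (f (h x) +_) (∑-map h xs f)

    ∑-concatMap : ∀ (h : A → List B) xs (f : B → ℕ) → ∑ (concatMap h xs) f ≡ ∑[ x ∈ xs ] ∑ (h x) f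
    ∑-concatMap h []       f = refl
    ∑-concatMap h (x ∷ xs) f = trans (∑-++ (h x) _ f) (cong (∑ (h x) f +_) (∑-concatMap h xs f))

    ∑-swap : ∀ xs ys (f : A → B → ℕ) → ∑[ x ∈ xs ] ∑[ y ∈ ys ] f x y ≡ ∑[ y ∈ ys ] ∑[ x ∈ xs ] f x y
    ∑-swap []       ys f = sym (trans (∑-const ys 0) (*-zeroʳ (length ys)))
    ∑-swap (x ∷ xs) ys f = trans (cong (∑ ys (f x) +_) (∑-swap xs ys f)) (sym (∑-+ ys (f x) _))

    ∑-* : ∀ xs ys (f : A → ℕ) (g : B → ℕ) → ∑[ x ∈ xs ] ∑[ y ∈ ys ] (f x * g y) ≡ ∑ xs f * ∑ ys g
    ∑-* xs ys f g = trans (∑-cong xs λ x → ∑-*ˡ ys (f x) g) (∑-*ʳ xs (∑ ys g) f)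

  -- Repetitions are allowed, so that there are exactly n^m tuples and sums over them split
  -- coordinate by coordinate. The few tuples with a repeated entry are paid for by taking n large.
  tuples : ∀ n m → List (Vec (Fin n) m)
  tuples n zero    = [] ∷ []
  tuples n (suc m) = concatMap (λ x → map (x ∷_) (tuples n m)) (allFin n)

  ∑-tuples : ∀ n m (f : Vec (Fin n) (suc m) → ℕ) →
             ∑ (tuples n (suc m)) f ≡ ∑[ x ∈ allFin n ] ∑[ v ∈ tuples n m ] f (x ∷ v)
  ∑-tuples n m f = trans (∑-concatMap _ (allFin n) f) (∑-cong (allFin n) λ x → ∑-map (x ∷_) (tuples n m) f)

  ∑-tuples-++ : ∀ {n} l m (f : Vec (Fin n) (l + m) → ℕ) →
                ∑ (tuples n (l + m)) f ≡ ∑[ v ∈ tuples n l ] ∑[ w ∈ tuples n m ] f (v Vec.++ w)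
  ∑-tuples-++     zero    m f = sym (+-identityʳ _)
  ∑-tuples-++ {n} (suc l) m f = begin
    ∑ (tuples n (suc l + m)) f
      ≡⟨ ∑-tuples n (l + m) f ⟩
    ∑[ x ∈ allFin n ] ∑[ v ∈ tuples n (l + m) ] f (x ∷ v)
      ≡⟨ ∑-cong (allFin n) (λ x → ∑-tuples-++ l m (f ∘ (x ∷_))) ⟩
    ∑[ x ∈ allFin n ] ∑[ v ∈ tuples n l ] ∑[ w ∈ tuples n m ] f (x ∷ v Vec.++ w)
      ≡⟨ ∑-tuples n l (λ v → ∑[ w ∈ tuples n m ] f (v Vec.++ w)) ⟨
    ∑[ v ∈ tuples n (suc l) ] ∑[ w ∈ tuples n m ] f (v Vec.++ w) ∎
    where open ≡-Reasoning

  length-allFin : ∀ n → length (allFin n) ≡ n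
  length-allFin n = length-tabulate {n = n} _

  ∑-1 : ∀ {A : Set} (xs : List A) → ∑[ _ ∈ xs ] 1 ≡ length xs
  ∑-1 xs = trans (∑-const xs 1) (*-identityʳ _)

  length-tuples : ∀ n m → length (tuples n m) ≡ n ^ m
  length-tuples n zero    = refl
  length-tuples n (suc m) = begin
    length (tuples n (suc m))                ≡⟨ ∑-1 (tuples n (suc m)) ⟨
    ∑[ _ ∈ tuples n (suc m) ] 1              ≡⟨ ∑-tuples n m (const 1) ⟩
    ∑[ _ ∈ allFin n ] ∑[ _ ∈ tuples n m ] 1  ≡⟨ ∑-const (allFin n) _ ⟩
    length (allFin n) * ∑[ _ ∈ tuples n m ] 1
      ≡⟨ cong₂ _*_ (length-allFin n) (trans (∑-1 (tuples n m)) (length-tuples n m)) ⟩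
    n ^ suc m                                ∎
    where open ≡-Reasoning

  ⟦_⟧ : Bool → ℕ
  ⟦ b ⟧ = if b then 1 else 0

  ⟦⟧≤1 : ∀ b → ⟦ b ⟧ ≤ 1
  ⟦⟧≤1 true  = ≤-refl
  ⟦⟧≤1 false = z≤n

  ⟦xor⟧-subadditive : ∀ a b → ⟦ a xor b ⟧ ≤ ⟦ a ⟧ + ⟦ b ⟧
  ⟦xor⟧-subadditive true  b = ≤-trans (⟦⟧≤1 (not b)) (m≤m+n 1 _)
  ⟦xor⟧-subadditive false b = ≤-refl

  -- Triangle-free graphs

  2mn≤m²+n² : ∀ m n → 2 * (m * n) ≤ m * m + n * n
  2mn≤m²+n² m n with ≤-total m n
  ... | inj₁ m≤n = ordered m≤n
    where
    square : ∀ m d → m * m + (m + d) * (m + d) ≡ 2 * (m * (m + d)) + d * d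
    square = solve-∀
    ordered : ∀ {m n} → m ≤ n → 2 * (m * n) ≤ m * m + n * n
    ordered {m} m≤n with m≤n⇒∃[o]m+o≡n m≤n
    ... | d , refl = subst (2 * (m * (m + d)) ≤_) (sym (square m d)) (m≤m+n _ (d * d))
  ... | inj₂ n≤m with m≤n⇒∃[o]m+o≡n n≤m
  ... | d , refl = subst (2 * ((n + d) * n) ≤_) (sym (square n d)) (m≤m+n _ (d * d))
    where
    square : ∀ m d → (m + d) * (m + d) + m * m ≡ 2 * ((m + d) * m) + d * d
    square = solve-∀

  module TriangleFree {A : Set} (xs : List A) (G : A → A → Bool)
    (G-sym : ∀ p q → G p q ≡ G q p)
    (triangle-free : ∀ {p q r} → G p q ≡ true → G q r ≡ true → G r p ≡ true → ⊥)
    where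

    open ≤-Reasoning

    M : ℕ
    M = length xs

    deg : A → ℕ
    deg u = ∑[ p ∈ xs ] ⟦ G p u ⟧

    E : ℕ
    E = ∑[ p ∈ xs ] ∑[ q ∈ xs ] ⟦ G p q ⟧

    -- The ordered pairs on which `G` differs from the complete bipartite graph between the
    -- neighbourhood of `u` and its complement.
    mismatches : A → ℕ
    mismatches u = ∑[ p ∈ xs ] ∑[ q ∈ xs ] ⟦ G p q xor (G p u xor G q u) ⟧

    E≡∑deg : E ≡ ∑ xs deg
    E≡∑deg = ∑-swap xs xs λ p q → ⟦ G p q ⟧

    ∑deg² : ℕ
    ∑deg² = ∑[ u ∈ xs ] (deg u * deg u)

    ∑-edges-deg : ∑[ u ∈ xs ] ∑[ w ∈ xs ] (⟦ G u w ⟧ * (deg u + deg w)) ≡ ∑deg² + ∑deg²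
    ∑-edges-deg = begin-equality
      ∑[ u ∈ xs ] ∑[ w ∈ xs ] (⟦ G u w ⟧ * (deg u + deg w))
        ≡⟨ ∑-cong xs (λ u → trans (∑-cong xs λ w → *-distribˡ-+ ⟦ G u w ⟧ (deg u) (deg w)) (∑-+ xs _ _)) ⟩
      ∑[ u ∈ xs ] (∑[ w ∈ xs ] (⟦ G u w ⟧ * deg u) + ∑[ w ∈ xs ] (⟦ G u w ⟧ * deg w))
        ≡⟨ ∑-+ xs _ _ ⟩
      ∑[ u ∈ xs ] ∑[ w ∈ xs ] (⟦ G u w ⟧ * deg u) + ∑[ u ∈ xs ] ∑[ w ∈ xs ] (⟦ G u w ⟧ * deg w)
        ≡⟨ cong₂ _+_ (∑-cong xs λ u → trans (∑-cong xs λ w → cong (λ b → ⟦ b ⟧ * deg u) (G-sym u w)) (∑-*ʳ xs (deg u) _))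
             (trans (∑-swap xs xs _) (∑-cong xs λ w → ∑-*ʳ xs (deg w) _)) ⟩
      ∑deg² + ∑deg² ∎

    -- Cauchy-Schwarz against the constant 1, obtained by summing 2ab ≤ a² + b² over all pairs of
    -- degrees.
    E²≤M∑deg² : E * E ≤ M * ∑deg²
    E²≤M∑deg² = *-cancelˡ-≤ 2 (begin
      2 * (E * E)
        ≡⟨ cong (λ e → 2 * (e * e)) E≡∑deg ⟩
      2 * (∑ xs deg * ∑ xs deg)
        ≡⟨ cong (2 *_) (∑-* xs xs deg deg) ⟨
      2 * ∑[ p ∈ xs ] ∑[ q ∈ xs ] (deg p * deg q)
        ≡⟨ trans (∑-cong xs λ p → ∑-*ˡ xs 2 _) (∑-*ˡ xs 2 _) ⟨
      ∑[ p ∈ xs ] ∑[ q ∈ xs ] (2 * (deg p * deg q))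
        ≤⟨ ∑-mono xs (λ p → ∑-mono xs λ q → 2mn≤m²+n² (deg p) (deg q)) ⟩
      ∑[ p ∈ xs ] ∑[ q ∈ xs ] (deg p * deg p + deg q * deg q)
        ≡⟨ trans (∑-cong xs λ p → ∑-+ xs _ _) (∑-+ xs _ _) ⟩
      ∑[ p ∈ xs ] ∑[ q ∈ xs ] (deg p * deg p) + ∑[ p ∈ xs ] ∑deg²
        ≡⟨ cong₂ _+_ (trans (∑-cong xs λ p → ∑-const xs _) (∑-*ˡ xs M _)) (∑-const xs _) ⟩
      M * ∑deg² + M * ∑deg²
        ≡⟨ cong (M * ∑deg² +_) (+-identityʳ _) ⟨
      2 * (M * ∑deg²) ∎)

    -- The average of `deg u + deg w` over the `E` ordered edges is 2 `∑deg²` / `E`, which by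
    -- Cauchy-Schwarz is at least 2 `E` / `M`.
    heavy-edge : 0 < E → ∃[ u ] ∃[ w ] (G u w ≡ true × 2 * E ≤ M * (deg u + deg w))
    heavy-edge 0<E = from-pick (∑-pick xs c-average)
      where
      -- With 2`E` - 1 in place of 2`E` the sums compare strictly, as `∑-pick` requires, and
      -- exceeding `c` means reaching 2`E`.
      c : ℕ
      c = pred (2 * E)

      instance
        E-nonZero : NonZero E
        E-nonZero = >-nonZero 0<E
        2E-nonZero : NonZero (2 * E)
        2E-nonZero = m*n≢0 2 E

      c-average : ∑[ u ∈ xs ] ∑[ w ∈ xs ] (⟦ G u w ⟧ * c)
             < ∑[ u ∈ xs ] ∑[ w ∈ xs ] (M * (⟦ G u w ⟧ * (deg u + deg w)))
      c-average = begin-strict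
        ∑[ u ∈ xs ] ∑[ w ∈ xs ] (⟦ G u w ⟧ * c) ≡⟨ trans (∑-cong xs λ u → ∑-*ʳ xs c _) (∑-*ʳ xs c _) ⟩
        E * c                                   <⟨ *-monoʳ-< E (≤-reflexive (suc-pred (2 * E))) ⟩
        E * (2 * E)                             ≡⟨ twice E E ⟩
        E * E + E * E                           ≤⟨ +-mono-≤ E²≤M∑deg² E²≤M∑deg² ⟩
        M * ∑deg² + M * ∑deg²                   ≡⟨ *-distribˡ-+ M _ _ ⟨
        M * (∑deg² + ∑deg²)                     ≡⟨ cong (M *_) ∑-edges-deg ⟨
        M * ∑[ u ∈ xs ] ∑[ w ∈ xs ] (⟦ G u w ⟧ * (deg u + deg w))
          ≡⟨ trans (∑-cong xs λ u → ∑-*ˡ xs M _) (∑-*ˡ xs M _) ⟨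
        ∑[ u ∈ xs ] ∑[ w ∈ xs ] (M * (⟦ G u w ⟧ * (deg u + deg w))) ∎
        where
        twice : ∀ a b → a * (2 * b) ≡ a * b + a * b
        twice = solve-∀

      edge : ∀ b d → ⟦ b ⟧ * c < M * (⟦ b ⟧ * d) → b ≡ true × 2 * E ≤ M * d
      -- A non-edge has weight 0 on both sides, so it cannot be a pair where the inequality is
      -- strict.
      edge false d lt = ⊥-elim (<⇒≢ lt (sym (*-zeroʳ M)))
      edge true  d lt = refl , (begin
        2 * E       ≡⟨ suc-pred (2 * E) ⟨
        suc c       ≡⟨ cong suc (+-identityʳ c) ⟨
        suc (1 * c) ≤⟨ lt ⟩
        M * (1 * d) ≡⟨ cong (M *_) (+-identityʳ d) ⟩
        M * d       ∎)

      from-pick : ∃[ u ] (∑[ w ∈ xs ] (⟦ G u w ⟧ * c) < ∑[ w ∈ xs ] (M * (⟦ G u w ⟧ * (deg u + deg w)))) →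
                  ∃[ u ] ∃[ w ] (G u w ≡ true × 2 * E ≤ M * (deg u + deg w))
      from-pick (u , lt) = let w , lt′ = ∑-pick xs lt in u , w , edge (G u w) _ lt′

    remainder : A → A → A → ℕ
    remainder u w p = ⟦ not (G p u ∨ G p w) ⟧

    module _ {u w : A} (uw : G u w ≡ true) where

      -- A common neighbour of `u` and `w` would complete a triangle on the edge `u w`, so the two
      -- neighbourhoods are disjoint.
      M≡deg+deg+remainder : M ≡ deg u + deg w + ∑ xs (remainder u w)
      M≡deg+deg+remainder = begin-equality
        M                                                       ≡⟨ ∑-1 xs ⟨
        ∑[ _ ∈ xs ] 1                                           ≡⟨ ∑-cong xs (λ p → exclusive (G p u) (G p w)
                                                                     λ pu pw → triangle-free pu uw (trans (G-sym w p) pw)) ⟩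
        ∑[ p ∈ xs ] (⟦ G p u ⟧ + ⟦ G p w ⟧ + remainder u w p)   ≡⟨ ∑-+ xs _ _ ⟩
        ∑[ p ∈ xs ] (⟦ G p u ⟧ + ⟦ G p w ⟧) + ∑ xs (remainder u w) ≡⟨ cong (_+ ∑ xs (remainder u w)) (∑-+ xs _ _) ⟩
        deg u + deg w + ∑ xs (remainder u w)                    ∎
        where
        exclusive : ∀ a b → (a ≡ true → b ≡ true → ⊥) → 1 ≡ ⟦ a ⟧ + ⟦ b ⟧ + ⟦ not (a ∨ b) ⟧
        exclusive true  true  ¬ab = ⊥-elim (¬ab refl refl)
        exclusive true  false ¬ab = refl
        exclusive false true  ¬ab = refl
        exclusive false false ¬ab = refl

      -- Call a pair separated if exactly one of its members is adjacent to `u`. A non-edge is a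
      -- mismatch exactly when it is separated, and a separated edge counts 1 on both sides. An edge
      -- that is not separated counts 2 on the left. The neighbourhood of `u` is independent, so
      -- both its ends lie outside; the neighbourhood of `w` is independent too, so some end is
      -- adjacent to neither, and the factor 2 pays for it. The term `⟦ G p q ⟧` on the left lets
      -- `E` cancel later against the number of separated pairs.
      mismatch-bound : ∀ p q → ⟦ G p q xor (G p u xor G q u) ⟧ + ⟦ G p q ⟧ ≤
                       ⟦ G p u xor G q u ⟧ + 2 * (remainder u w p + remainder u w q)
      mismatch-bound p q = bound (G p q) (G p u) (G q u) (G p w) (G q w)
        (λ pq pu qu → triangle-free pq qu (trans (G-sym u p) pu))
        (λ pq pw qw → triangle-free pq qw (trans (G-sym w p) pw))
        where
        bound : ∀ g a a′ b b′ → (g ≡ true → a ≡ true → a′ ≡ true → ⊥) → (g ≡ true → b ≡ true → b′ ≡ true → ⊥) →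
                ⟦ g xor (a xor a′) ⟧ + ⟦ g ⟧ ≤ ⟦ a xor a′ ⟧ + 2 * (⟦ not (a ∨ b) ⟧ + ⟦ not (a′ ∨ b′) ⟧)
        bound false a     a′    b     b′    _  _  = +-monoʳ-≤ ⟦ a xor a′ ⟧ z≤n
        bound true  true  true  b     b′    ¬a _  = ⊥-elim (¬a refl refl refl)
        bound true  true  false b     b′    _  _  = m≤m+n 1 _
        bound true  false true  b     b′    _  _  = m≤m+n 1 _
        bound true  false false true  true  _  ¬b = ⊥-elim (¬b refl refl refl)
        bound true  false false true  false _  _  = ≤-refl
        bound true  false false false b′    _  _  = *-monoʳ-≤ 2 (m≤m+n 1 _)

    cross : A → ℕ
    cross u = ∑[ p ∈ xs ] ∑[ q ∈ xs ] ⟦ G p u xor G q u ⟧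

    -- If α vertices are adjacent to `u` and β are not, then 2αβ ordered pairs are separated, and
    -- 4αβ ≤ (α + β)².
    2cross≤M² : ∀ u → 2 * cross u ≤ M * M
    2cross≤M² u = begin
      2 * cross u
        ≡⟨ cong (2 *_) (∑-cong xs λ p → trans (∑-cong xs λ q → xor-split (G p u) (G q u)) (∑-+ xs _ _)) ⟩
      2 * ∑[ p ∈ xs ] (∑[ q ∈ xs ] (⟦ G p u ⟧ * ⟦ not (G q u) ⟧) + ∑[ q ∈ xs ] (⟦ not (G p u) ⟧ * ⟦ G q u ⟧))
        ≡⟨ cong (2 *_) (trans (∑-+ xs _ _) (cong₂ _+_ (∑-* xs xs _ _) (∑-* xs xs _ _))) ⟩
      2 * (α * β + β * α)           ≡⟨ rearrange α β ⟩
      2 * (α * β) + 2 * (α * β)     ≤⟨ +-monoˡ-≤ _ (2mn≤m²+n² α β) ⟩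
      α * α + β * β + 2 * (α * β)   ≡⟨ square α β ⟨
      (α + β) * (α + β)             ≡⟨ cong₂ _*_ α+β≡M α+β≡M ⟩
      M * M                         ∎
      where
      α β : ℕ
      α = deg u
      β = ∑[ p ∈ xs ] ⟦ not (G p u) ⟧

      xor-split : ∀ a b → ⟦ a xor b ⟧ ≡ ⟦ a ⟧ * ⟦ not b ⟧ + ⟦ not a ⟧ * ⟦ b ⟧
      xor-split true  b = sym (trans (+-identityʳ _) (+-identityʳ _))
      xor-split false b = sym (+-identityʳ _)

      complementary : ∀ a → ⟦ a ⟧ + ⟦ not a ⟧ ≡ 1
      complementary true  = refl
      complementary false = refl

      α+β≡M : α + β ≡ M
      α+β≡M = trans (sym (∑-+ xs _ _)) (trans (∑-cong xs λ p → complementary (G p u)) (∑-1 xs))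

      rearrange : ∀ a b → 2 * (a * b + b * a) ≡ 2 * (a * b) + 2 * (a * b)
      rearrange = solve-∀

      square : ∀ a b → (a + b) * (a + b) ≡ a * a + b * b + 2 * (a * b)
      square = solve-∀

    -- An end `u` of a heavy edge works. Summing `mismatch-bound` and doubling leaves 2 `cross u`,
    -- which is at most `M`² ≤ 2`E` + `D`, and 8 `M` `R`, where the heavy edge forces `M` `R` ≤ `D`;
    -- hence 9 = 1 + 8.
    stability : A → ∀ {D} → M * M ≤ 2 * E + D → ∃[ u ] 2 * mismatches u ≤ 9 * D
    stability u₀ {D} M²≤2E+D with E ≟ 0
    -- Without edges there is no heavy edge, but then `D` is at least `M`² and the fallback vertex
    -- `u₀` will do.
    ... | yes E≡0 = u₀ , *-mono-≤ {2} {9} (m≤m+n 2 7) (begin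
      mismatches u₀             ≤⟨ ∑-mono xs (λ p → ∑-mono xs λ q → ⟦⟧≤1 _) ⟩
      ∑[ p ∈ xs ] ∑[ q ∈ xs ] 1 ≡⟨ ∑-cong xs (λ p → ∑-1 xs) ⟩
      ∑[ p ∈ xs ] M             ≡⟨ ∑-const xs M ⟩
      M * M                     ≤⟨ M²≤2E+D ⟩
      2 * E + D                 ≡⟨ cong (λ e → 2 * e + D) E≡0 ⟩
      D                         ∎)
    ... | no  E≢0 with heavy-edge (n≢0⇒n>0 E≢0)
    ... | u , w , uw , 2E≤ = u , +-cancelʳ-≤ (2 * E) (2 * mismatches u) (9 * D) (begin
      2 * mismatches u + 2 * E
        ≡⟨ *-distribˡ-+ 2 (mismatches u) E ⟨
      2 * (mismatches u + E)
        ≡⟨ cong (2 *_) (trans (∑-cong xs λ p → ∑-+ xs _ _) (∑-+ xs _ _)) ⟨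
      2 * ∑[ p ∈ xs ] ∑[ q ∈ xs ] (⟦ G p q xor (G p u xor G q u) ⟧ + ⟦ G p q ⟧)
        ≤⟨ *-monoʳ-≤ 2 (∑-mono xs λ p → ∑-mono xs λ q → mismatch-bound uw p q) ⟩
      2 * ∑[ p ∈ xs ] ∑[ q ∈ xs ] (⟦ G p u xor G q u ⟧ + 2 * (r p + r q))
        ≡⟨ cong (2 *_) (trans (∑-cong xs λ p → ∑-+ xs _ _) (∑-+ xs _ _)) ⟩
      2 * (cross u + ∑[ p ∈ xs ] ∑[ q ∈ xs ] (2 * (r p + r q)))
        ≡⟨ cong (λ s → 2 * (cross u + s)) (trans (trans (∑-cong xs λ p → ∑-*ˡ xs 2 _) (∑-*ˡ xs 2 _)) (cong (2 *_) ∑r+r)) ⟩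
      2 * (cross u + 2 * (M * R + M * R))
        ≡⟨ rearrange (cross u) (M * R) ⟩
      2 * cross u + 8 * (M * R)
        ≤⟨ +-mono-≤ (2cross≤M² u) (*-monoʳ-≤ 8 MR≤D) ⟩
      M * M + 8 * D
        ≤⟨ +-monoˡ-≤ (8 * D) M²≤2E+D ⟩
      2 * E + D + 8 * D
        ≡⟨ collect (2 * E) D ⟩
      9 * D + 2 * E ∎)
      where
      r : A → ℕ
      r = remainder u w

      R : ℕ
      R = ∑ xs r

      ∑r+r : ∑[ p ∈ xs ] ∑[ q ∈ xs ] (r p + r q) ≡ M * R + M * R
      ∑r+r = trans (trans (∑-cong xs λ p → ∑-+ xs _ _) (∑-+ xs _ _))
        (cong₂ _+_ (trans (∑-cong xs λ p → ∑-const xs (r p)) (∑-*ˡ xs M r)) (∑-const xs R))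

      MR≤D : M * R ≤ D
      MR≤D = +-cancelˡ-≤ (M * (deg u + deg w)) (M * R) D (begin
        M * (deg u + deg w) + M * R ≡⟨ *-distribˡ-+ M _ R ⟨
        M * (deg u + deg w + R)     ≡⟨ cong (M *_) (M≡deg+deg+remainder uw) ⟨
        M * M                       ≤⟨ M²≤2E+D ⟩
        2 * E + D                   ≤⟨ +-monoˡ-≤ D 2E≤ ⟩
        M * (deg u + deg w) + D     ∎)

      rearrange : ∀ x y → 2 * (x + 2 * (y + y)) ≡ 2 * x + 8 * y
      rearrange = solve-∀

      collect : ∀ e d → e + d + 8 * d ≡ 9 * d + e
      collect = solve-∀

  -- Sets and tuples

  ∣∷∣ : ∀ {n} s (S : Subset n) → ∣ s ∷ S ∣ ≡ ⟦ s ⟧ + ∣ S ∣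
  ∣∷∣ true  S = refl
  ∣∷∣ false S = refl

  #subsets≡∑ : ∀ {n} {P : Pred (Subset n) _} (P? : Decidable P) → #subsets P? ≡ ∑[ S ∈ subsets n ] ⟦ does (P? S) ⟧
  #subsets≡∑ {n} P? = go (subsets n)
    where
    go : ∀ Ss → length (filter P? Ss) ≡ ∑[ S ∈ Ss ] ⟦ does (P? S) ⟧
    go []       = refl
    go (S ∷ Ss) with does (P? S)
    ... | true  = cong suc (go Ss)
    ... | false = go Ss

  -- The correction for an element already present stands on the left, which avoids truncated
  -- subtraction. It serves twice: with `T` = `⊤` for sizes, and with `T` = {g = 1} for parities.
  insert-∩ : ∀ {n} (x : Fin n) S T →
             ∣ (⁅ x ⁆ ∪ S) ∩ T ∣ + ⟦ lookup S x ∧ lookup T x ⟧ ≡ ⟦ lookup T x ⟧ + ∣ S ∩ T ∣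
  insert-∩ zero (s ∷ S) (t ∷ T) = begin
    ∣ t ∷ (∅ ∪ S) ∩ T ∣ + ⟦ s ∧ t ⟧     ≡⟨ cong (λ R → ∣ t ∷ R ∩ T ∣ + ⟦ s ∧ t ⟧) (∪-identityˡ S) ⟩
    ∣ t ∷ S ∩ T ∣ + ⟦ s ∧ t ⟧           ≡⟨ cong (_+ ⟦ s ∧ t ⟧) (∣∷∣ t (S ∩ T)) ⟩
    ⟦ t ⟧ + ∣ S ∩ T ∣ + ⟦ s ∧ t ⟧       ≡⟨ swap ⟦ t ⟧ ∣ S ∩ T ∣ ⟦ s ∧ t ⟧ ⟩
    ⟦ t ⟧ + (⟦ s ∧ t ⟧ + ∣ S ∩ T ∣)     ≡⟨ cong (⟦ t ⟧ +_) (∣∷∣ (s ∧ t) (S ∩ T)) ⟨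
    ⟦ t ⟧ + ∣ (s ∷ S) ∩ (t ∷ T) ∣       ∎
    where
    open ≡-Reasoning
    swap : ∀ a b c → a + b + c ≡ a + (c + b)
    swap = solve-∀
  insert-∩ (suc x) (s ∷ S) (t ∷ T) = begin
    ∣ s ∧ t ∷ (⁅ x ⁆ ∪ S) ∩ T ∣ + l              ≡⟨ cong (_+ l) (∣∷∣ (s ∧ t) ((⁅ x ⁆ ∪ S) ∩ T)) ⟩
    ⟦ s ∧ t ⟧ + ∣ (⁅ x ⁆ ∪ S) ∩ T ∣ + l          ≡⟨ +-assoc ⟦ s ∧ t ⟧ _ l ⟩
    ⟦ s ∧ t ⟧ + (∣ (⁅ x ⁆ ∪ S) ∩ T ∣ + l)        ≡⟨ cong (⟦ s ∧ t ⟧ +_) (insert-∩ x S T) ⟩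
    ⟦ s ∧ t ⟧ + (⟦ lookup T x ⟧ + ∣ S ∩ T ∣)     ≡⟨ swap ⟦ s ∧ t ⟧ ⟦ lookup T x ⟧ ∣ S ∩ T ∣ ⟩
    ⟦ lookup T x ⟧ + (⟦ s ∧ t ⟧ + ∣ S ∩ T ∣)     ≡⟨ cong (⟦ lookup T x ⟧ +_) (∣∷∣ (s ∧ t) (S ∩ T)) ⟨
    ⟦ lookup T x ⟧ + ∣ (s ∷ S) ∩ (t ∷ T) ∣       ∎
    where
    open ≡-Reasoning
    l : ℕ
    l = ⟦ lookup S x ∧ lookup T x ⟧
    swap : ∀ a b c → a + (b + c) ≡ b + (a + c)
    swap = solve-∀

  ∣insert∣ : ∀ {n} (x : Fin n) S → ∣ ⁅ x ⁆ ∪ S ∣ + ⟦ lookup S x ⟧ ≡ suc ∣ S ∣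
  ∣insert∣ {n} x S = begin
    ∣ ⁅ x ⁆ ∪ S ∣ + ⟦ lookup S x ⟧
      ≡⟨ cong₂ (λ R b → ∣ R ∣ + ⟦ b ⟧) (sym (∩-identityʳ (⁅ x ⁆ ∪ S))) (sym (∧-true (lookup S x) (lookup-replicate x true))) ⟩
    ∣ (⁅ x ⁆ ∪ S) ∩ ⊤ ∣ + ⟦ lookup S x ∧ lookup ⊤ x ⟧
      ≡⟨ insert-∩ x S ⊤ ⟩
    ⟦ lookup ⊤ x ⟧ + ∣ S ∩ ⊤ ∣
      ≡⟨ cong₂ (λ b R → ⟦ b ⟧ + ∣ R ∣) (lookup-replicate x true) (∩-identityʳ S) ⟩
    suc ∣ S ∣ ∎
    where
    open ≡-Reasoning
    ∧-true : ∀ a {b} → b ≡ true → a ∧ b ≡ a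
    ∧-true true  refl = refl
    ∧-true false refl = refl

  ∣∪∣+∣∩∣ : ∀ {n} (S T : Subset n) → ∣ S ∪ T ∣ + ∣ S ∩ T ∣ ≡ ∣ S ∣ + ∣ T ∣
  ∣∪∣+∣∩∣ []          []          = refl
  ∣∪∣+∣∩∣ (true  ∷ S) (true  ∷ T) = cong suc (trans (+-suc _ _) (trans (cong suc (∣∪∣+∣∩∣ S T)) (sym (+-suc _ _))))
  ∣∪∣+∣∩∣ (true  ∷ S) (false ∷ T) = cong suc (∣∪∣+∣∩∣ S T)
  ∣∪∣+∣∩∣ (false ∷ S) (true  ∷ T) = trans (cong suc (∣∪∣+∣∩∣ S T)) (sym (+-suc _ _))
  ∣∪∣+∣∩∣ (false ∷ S) (false ∷ T) = ∣∪∣+∣∩∣ S T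

  ∣S∣≡0⇒Empty : ∀ {n} (S : Subset n) → ∣ S ∣ ≡ 0 → Empty S
  ∣S∣≡0⇒Empty S ∣S∣≡0 (x , x∈S) = n≮0 (<-≤-trans (x∈p⇒∣p-x∣<∣p∣ x∈S) (≤-reflexive ∣S∣≡0))

  -- Inclusion-exclusion leaves no slack. Adjacent tuples therefore have disjoint supports of size
  -- k, and a triangle of tuples is a genuine copy of 𝒞₃.
  union-of-full-size : ∀ {n k} {S T : Subset n} → ∣ S ∣ ≤ k → ∣ T ∣ ≤ k → ∣ S ∪ T ∣ ≡ 2 * k → ∣ S ∣ ≡ k × Empty (S ∩ T)
  union-of-full-size {k = k} {S} {T} S≤k T≤k ∪≡2k =
    ≤-antisym S≤k (+-cancelʳ-≤ k k ∣ S ∣ (begin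
      k + k                     ≤⟨ m≤m+n _ _ ⟩
      k + k + ∣ S ∩ T ∣         ≡⟨ total ⟩
      ∣ S ∣ + ∣ T ∣             ≤⟨ +-monoʳ-≤ ∣ S ∣ T≤k ⟩
      ∣ S ∣ + k                 ∎)) ,
    ∣S∣≡0⇒Empty (S ∩ T) (n≤0⇒n≡0 (+-cancelˡ-≤ (k + k) _ 0 (begin
      k + k + ∣ S ∩ T ∣         ≡⟨ total ⟩
      ∣ S ∣ + ∣ T ∣             ≤⟨ +-mono-≤ S≤k T≤k ⟩
      k + k                     ≡⟨ +-identityʳ _ ⟨
      k + k + 0                 ∎)))
    where
    open ≤-Reasoning
    total : k + k + ∣ S ∩ T ∣ ≡ ∣ S ∣ + ∣ T ∣
    total = trans (cong (_+ ∣ S ∩ T ∣) (sym (trans ∪≡2k (cong (k +_) (+-identityʳ k))))) (∣∪∣+∣∩∣ S T)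

  ∑-allFin-suc : ∀ n (f : Fin (suc n) → ℕ) → ∑ (allFin (suc n)) f ≡ f zero + ∑ (allFin n) (f ∘ suc)
  ∑-allFin-suc n f = cong (f zero +_) (trans (cong (λ xs → ∑ xs f) (sym (map-tabulate id suc))) (∑-map suc (allFin n) f))

  ∑-subsets-suc : ∀ n (F : Subset (suc n) → ℕ) →
                  ∑ (subsets (suc n)) F ≡ ∑[ S ∈ subsets n ] F (true ∷ S) + ∑[ S ∈ subsets n ] F (false ∷ S)
  ∑-subsets-suc n F = trans (∑-++ (map (true ∷_) (subsets n)) _ F) (cong₂ _+_ (∑-map _ (subsets n) F) (∑-map _ (subsets n) F))

  -- Double counting: a set T arises as `⁅ x ⁆ ∪ S` with x outside S once for each of its elements.
  -- The induction splits off vertex 0, whose insertion is possible only into the sets that miss it.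
  ∑-insert : ∀ n (F : Subset n → ℕ) →
             ∑[ S ∈ subsets n ] ∑[ x ∈ allFin n ] (⟦ not (lookup S x) ⟧ * F (⁅ x ⁆ ∪ S)) ≡ ∑[ S ∈ subsets n ] (∣ S ∣ * F S)
  ∑-insert zero    F = refl
  ∑-insert (suc n) F = begin
    ∑[ S ∈ subsets (suc n) ] ∑[ x ∈ allFin (suc n) ] (⟦ not (lookup S x) ⟧ * F (⁅ x ⁆ ∪ S))
      ≡⟨ ∑-subsets-suc n _ ⟩
    ∑[ S ∈ subsets n ] ∑[ x ∈ allFin (suc n) ] (⟦ not (lookup (true ∷ S) x) ⟧ * F (⁅ x ⁆ ∪ (true ∷ S))) +
    ∑[ S ∈ subsets n ] ∑[ x ∈ allFin (suc n) ] (⟦ not (lookup (false ∷ S) x) ⟧ * F (⁅ x ⁆ ∪ (false ∷ S)))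
      ≡⟨ cong₂ _+_ (∑-cong (subsets n) λ S → ∑-allFin-suc n λ x → ⟦ not (lookup (true ∷ S) x) ⟧ * F (⁅ x ⁆ ∪ (true ∷ S)))
           (trans (∑-cong (subsets n) λ S → trans (∑-allFin-suc n _) (cong (_+ ins false S) (first S))) (∑-+ (subsets n) _ _)) ⟩
    ∑[ S ∈ subsets n ] ins true S + (∑[ S ∈ subsets n ] F (true ∷ S) + ∑[ S ∈ subsets n ] ins false S)
      ≡⟨ cong₂ (λ a b → a + (∑[ S ∈ subsets n ] F (true ∷ S) + b)) (∑-insert n (F ∘ (true ∷_))) (∑-insert n (F ∘ (false ∷_))) ⟩
    ∑[ S ∈ subsets n ] (∣ S ∣ * F (true ∷ S)) + (∑[ S ∈ subsets n ] F (true ∷ S) + ∑[ S ∈ subsets n ] (∣ S ∣ * F (false ∷ S)))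
      ≡⟨ rearrange (∑[ S ∈ subsets n ] (∣ S ∣ * F (true ∷ S))) (∑[ S ∈ subsets n ] F (true ∷ S)) (∑[ S ∈ subsets n ] (∣ S ∣ * F (false ∷ S))) ⟩
    (∑[ S ∈ subsets n ] F (true ∷ S) + ∑[ S ∈ subsets n ] (∣ S ∣ * F (true ∷ S))) + ∑[ S ∈ subsets n ] (∣ S ∣ * F (false ∷ S))
      ≡⟨ cong (_+ ∑[ S ∈ subsets n ] (∣ S ∣ * F (false ∷ S))) (∑-+ (subsets n) _ _) ⟨
    ∑[ S ∈ subsets n ] (suc ∣ S ∣ * F (true ∷ S)) + ∑[ S ∈ subsets n ] (∣ S ∣ * F (false ∷ S))
      ≡⟨ ∑-subsets-suc n _ ⟨
    ∑[ S ∈ subsets (suc n) ] (∣ S ∣ * F S) ∎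
    where
    open ≡-Reasoning
    ins : Bool → Subset n → ℕ
    ins s S = ∑[ x ∈ allFin n ] (⟦ not (lookup S x) ⟧ * F (s ∷ (⁅ x ⁆ ∪ S)))
    first : ∀ S → 1 * F (true ∷ (∅ ∪ S)) ≡ F (true ∷ S)
    first S = trans (+-identityʳ _) (cong (F ∘ (true ∷_)) (∪-identityˡ S))
    rearrange : ∀ a b c → a + (b + c) ≡ b + a + c
    rearrange = solve-∀

  support : ∀ {n m} → Vec (Fin n) m → Subset n
  support []      = ∅
  support (x ∷ v) = ⁅ x ⁆ ∪ support v

  support-++ : ∀ {n l m} (v : Vec (Fin n) l) (w : Vec (Fin n) m) → support (v Vec.++ w) ≡ support v ∪ support w
  support-++ []      w = sym (∪-identityˡ _)
  support-++ (x ∷ v) w = trans (cong (⁅ x ⁆ ∪_) (support-++ v w)) (sym (∪-assoc ⁅ x ⁆ (support v) (support w)))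

  ∣support∣≤ : ∀ {n m} (v : Vec (Fin n) m) → ∣ support v ∣ ≤ m
  ∣support∣≤ {n} []  = ≤-reflexive (∣⊥∣≡0 n)
  ∣support∣≤ (x ∷ v) = ≤-trans (m≤m+n _ ⟦ lookup (support v) x ⟧) (≤-trans (≤-reflexive (∣insert∣ x (support v))) (s≤s (∣support∣≤ v)))

  -- Each r-set is the support of r! tuples.
  ∑-subsets≤∑-tuples : ∀ {n} r (F : Subset n → ℕ) → (∀ S → ∣ S ∣ ≢ r → F S ≡ 0) →
                       r ! * ∑ (subsets n) F ≤ ∑[ v ∈ tuples n r ] F (support v)
  ∑-subsets≤∑-tuples zero F F-supp = +-mono-≤ (at-∅ _ F F-supp) z≤n
    where
    at-∅ : ∀ n (F : Subset n → ℕ) → (∀ S → ∣ S ∣ ≢ 0 → F S ≡ 0) → ∑ (subsets n) F ≤ F ∅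
    at-∅ zero    F _  = ≤-reflexive (+-identityʳ _)
    at-∅ (suc n) F F0 = begin
      ∑ (subsets (suc n)) F
        ≡⟨ ∑-subsets-suc n F ⟩
      ∑[ S ∈ subsets n ] F (true ∷ S) + ∑[ S ∈ subsets n ] F (false ∷ S)
        ≡⟨ cong (_+ ∑[ S ∈ subsets n ] F (false ∷ S)) (trans (∑-cong (subsets n) λ S → F0 (true ∷ S) λ ()) (trans (∑-const (subsets n) 0) (*-zeroʳ (length (subsets n))))) ⟩
      ∑[ S ∈ subsets n ] F (false ∷ S)
        ≤⟨ at-∅ n (F ∘ (false ∷_)) (F0 ∘ (false ∷_)) ⟩
      F ∅ ∎
      where open ≤-Reasoning
  ∑-subsets≤∑-tuples {n} (suc r) F F-supp = begin
    suc r ! * ∑ (subsets n) F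
      ≡⟨ rearrange (suc r) (r !) _ ⟩
    r ! * (suc r * ∑ (subsets n) F)
      ≡⟨ cong (r ! *_) (trans (∑-cong (subsets n) size) (∑-*ˡ (subsets n) (suc r) F)) ⟨
    r ! * ∑[ S ∈ subsets n ] (∣ S ∣ * F S)
      ≡⟨ cong (r ! *_) (∑-insert n F) ⟨
    r ! * ∑[ S ∈ subsets n ] ∑[ x ∈ allFin n ] F⁺ x S
      ≡⟨ cong (r ! *_) (∑-swap (subsets n) (allFin n) _) ⟩
    r ! * ∑[ x ∈ allFin n ] ∑[ S ∈ subsets n ] F⁺ x S
      ≡⟨ ∑-*ˡ (allFin n) (r !) _ ⟨
    ∑[ x ∈ allFin n ] (r ! * ∑[ S ∈ subsets n ] F⁺ x S)
      ≤⟨ ∑-mono (allFin n) (λ x → ∑-subsets≤∑-tuples r (F⁺ x) (F⁺-supp x)) ⟩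
    ∑[ x ∈ allFin n ] ∑[ v ∈ tuples n r ] F⁺ x (support v)
      ≤⟨ ∑-mono (allFin n) (λ x → ∑-mono (tuples n r) λ v →
           ≤-trans (*-monoˡ-≤ (F (support (x ∷ v))) (⟦⟧≤1 (not (lookup (support v) x)))) (≤-reflexive (+-identityʳ _))) ⟩
    ∑[ x ∈ allFin n ] ∑[ v ∈ tuples n r ] F (support (x ∷ v))
      ≡⟨ ∑-tuples n r (F ∘ support) ⟨
    ∑[ v ∈ tuples n (suc r) ] F (support v) ∎
    where
    open ≤-Reasoning
    -- The element must be new: otherwise an (r+1)-set containing x would arise from itself, and
    -- `F⁺ x` would not vanish off the r-sets.
    F⁺ : Fin n → Subset n → ℕ
    F⁺ x S = ⟦ not (lookup S x) ⟧ * F (⁅ x ⁆ ∪ S)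

    F⁺-supp : ∀ x S → ∣ S ∣ ≢ r → F⁺ x S ≡ 0
    F⁺-supp x S ∣S∣≢r with lookup S x | ∣insert∣ x S
    ... | true  | _  = refl
    ... | false | eq = trans (+-identityʳ _) (F-supp _ λ eq′ → ∣S∣≢r (suc-injective (trans (sym eq) (trans (+-identityʳ _) eq′))))

    size : ∀ S → ∣ S ∣ * F S ≡ suc r * F S
    size S with ∣ S ∣ ≟ suc r
    ... | yes eq = cong (_* F S) eq
    ... | no neq = trans (cong (∣ S ∣ *_) (F-supp S neq)) (trans (*-zeroʳ ∣ S ∣)
                     (sym (trans (cong (suc r *_) (F-supp S neq)) (*-zeroʳ (suc r)))))

    rearrange : ∀ a b c → a * b * c ≡ b * (a * c)
    rearrange = solve-∀

  sumᵇ : ∀ {n m} → (Fin n → Bool) → Vec (Fin n) m → Bool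
  sumᵇ g []      = false
  sumᵇ g (x ∷ v) = g x xor sumᵇ g v

  sumᵇ-++ : ∀ {n l m} (g : Fin n → Bool) (v : Vec (Fin n) l) (w : Vec (Fin n) m) →
            sumᵇ g (v Vec.++ w) ≡ sumᵇ g v xor sumᵇ g w
  sumᵇ-++ g []      w = refl
  sumᵇ-++ g (x ∷ v) w = trans (cong (g x xor_) (sumᵇ-++ g v w)) (sym (xor-assoc (g x) _ _))

  odd : ℕ → Bool
  odd m = does (odd? m)

  odd-suc : ∀ m → odd (suc m) ≡ not (odd m)
  odd-suc m with parity (suc m) | parity m | suc-homo-⁻¹ m
  ... | 0ℙ | 1ℙ | _ = refl
  ... | 1ℙ | 0ℙ | _ = refl

  odd-+ : ∀ l m → odd (l + m) ≡ odd l xor odd m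
  odd-+ zero    m = refl
  odd-+ (suc l) m = trans (odd-suc (l + m)) (trans (cong not (odd-+ l m))
    (trans (not-distribˡ-xor (odd l) (odd m)) (cong (_xor odd m) (sym (odd-suc l)))))

  -- A tuple with full support has no repetition, so each entry x adds `g x` to the intersection
  -- with {g = 1}. A repeated entry would count twice in `sumᵇ` but only once in the support.
  odd-∩ : ∀ {n m} (g : Fin n → Bool) (v : Vec (Fin n) m) → ∣ support v ∣ ≡ m →
          odd ∣ support v ∩ Vec.tabulate g ∣ ≡ sumᵇ g v
  odd-∩ {n} g [] _ = cong odd (n≤0⇒n≡0 (≤-trans (∣p∩q∣≤∣p∣ ∅ (Vec.tabulate g)) (≤-reflexive (∣⊥∣≡0 n))))
  odd-∩ {m = suc m} g (x ∷ v) full = begin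
    odd ∣ support (x ∷ v) ∩ V ∣                                  ≡⟨ cong odd (+-identityʳ ∣ support (x ∷ v) ∩ V ∣) ⟨
    odd (∣ support (x ∷ v) ∩ V ∣ + 0)                            ≡⟨ cong (λ b → odd (∣ support (x ∷ v) ∩ V ∣ + ⟦ b ∧ lookup V x ⟧)) new ⟨
    odd (∣ support (x ∷ v) ∩ V ∣ + ⟦ lookup (support v) x ∧ lookup V x ⟧) ≡⟨ cong odd (insert-∩ x (support v) V) ⟩
    odd (⟦ lookup V x ⟧ + ∣ support v ∩ V ∣)                     ≡⟨ odd-+ ⟦ lookup V x ⟧ _ ⟩
    odd ⟦ lookup V x ⟧ xor odd ∣ support v ∩ V ∣                 ≡⟨ cong₂ _xor_ (trans (odd-⟦⟧ (lookup V x)) (lookup∘tabulate g x)) (odd-∩ g v full′) ⟩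
    g x xor sumᵇ g v                                             ∎
    where
    open ≡-Reasoning
    V : Subset _
    V = Vec.tabulate g
    odd-⟦⟧ : ∀ b → odd ⟦ b ⟧ ≡ b
    odd-⟦⟧ true  = refl
    odd-⟦⟧ false = refl
    size : m + ⟦ lookup (support v) x ⟧ ≡ ∣ support v ∣
    size = suc-injective (trans (cong (_+ ⟦ lookup (support v) x ⟧) (sym full)) (∣insert∣ x (support v)))
    -- Had x occurred in v, the support of the m-tuple v would have m + 1 elements.
    new : lookup (support v) x ≡ false
    new with lookup (support v) x | size
    ... | false | _  = refl
    ... | true  | eq = ⊥-elim (<⇒≱ (≤-reflexive (trans (+-comm 1 m) eq)) (∣support∣≤ v))
    full′ : ∣ support v ∣ ≡ m
    full′ = trans (sym size) (trans (cong (λ b → m + ⟦ b ⟧) new) (+-identityʳ m))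

  -- Linearisation

  -- The Hamming triangle inequality. Each use comes with an identity over 𝔽₂ that writes a new
  -- discrepancy as a sum of old ones.
  ⟦⟧-triangle : ∀ {a} b c → a ≡ b xor c → ⟦ a ⟧ ≤ ⟦ b ⟧ + ⟦ c ⟧
  ⟦⟧-triangle b c refl = ⟦xor⟧-subadditive b c

  ∪-exchange : ∀ {n} (R S T : Subset n) → R ∪ (S ∪ T) ≡ S ∪ (R ∪ T)
  ∪-exchange R S T = trans (sym (∪-assoc R S T)) (trans (cong (_∪ T) (∪-comm R S)) (∪-assoc S R T))

  ∪-swap-last : ∀ {n} (R S T U : Subset n) → (R ∪ S) ∪ (T ∪ U) ≡ (R ∪ U) ∪ (T ∪ S)
  ∪-swap-last R S T U = trans (∪-assoc R S (T ∪ U)) (trans (cong (R ∪_) eq) (sym (∪-assoc R U (T ∪ S))))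
    where
    eq : S ∪ (T ∪ U) ≡ U ∪ (T ∪ S)
    eq = trans (∪-comm S (T ∪ U)) (trans (cong (_∪ S) (∪-comm T U)) (∪-assoc U T S))

  module Linearisation (n : ℕ) .{{_ : NonZero n}} where

    open ≤-Reasoning

    0<∣allFin∣ : 0 < length (allFin n)
    0<∣allFin∣ = subst (0 <_) (sym (length-allFin n)) (>-nonZero⁻¹ n)

    0<∣tuples∣ : ∀ m → 0 < length (tuples n m)
    0<∣tuples∣ m = subst (0 <_) (sym (length-tuples n m)) (m^n>0 n m)

    -- Two functions occur because adding x passes from m entries to m + 1: `φ` is read on the
    -- longer tuples, `ψ` on the shorter ones.
    sum-error : ∀ m → (Fin n → Bool) → (φ ψ : Subset n → Bool) → ℕ
    sum-error m g φ ψ =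
      ∑[ x ∈ allFin n ] ∑[ v ∈ tuples n m ] ⟦ φ (⁅ x ⁆ ∪ support v) xor (ψ (support v) xor g x) ⟧

    affine-error : ∀ m → (Fin n → Bool) → (Subset n → Bool) → Bool → ℕ
    affine-error m g φ c = ∑[ v ∈ tuples n m ] ⟦ φ (support v) xor (c xor sumᵇ g v) ⟧

    shift : (Fin n → Bool) → (Subset n → Bool) → Fin n → Subset n → Bool
    shift g ψ b S = ψ (⁅ b ⁆ ∪ S) xor g b

    -- φ(x y R) is ψ(y R) + g x and also ψ(x R) + g y, so ψ(y R) - g y hardly depends on y.
    shift-error : ∀ m g φ ψ →
      ∑[ b ∈ allFin n ] sum-error m g ψ (shift g ψ b) ≤ 2 * sum-error (suc m) g φ ψ
    shift-error m g φ ψ = begin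
      ∑[ x ∈ allFin n ] ∑[ y ∈ allFin n ] ∑[ v ∈ tuples n m ]
        ⟦ ψ (⁅ y ⁆ ∪ support v) xor (shift g ψ x (support v) xor g y) ⟧
        ≤⟨ ∑-mono (allFin n) (λ x → ∑-mono (allFin n) λ y → ∑-mono (tuples n m) λ v → pointwise x y v) ⟩
      ∑[ x ∈ allFin n ] ∑[ y ∈ allFin n ] ∑[ v ∈ tuples n m ] (err x y v + err y x v)
        ≡⟨ trans (∑-cong (allFin n) λ x → trans (∑-cong (allFin n) λ y → ∑-+ (tuples n m) _ _) (∑-+ (allFin n) _ _)) (∑-+ (allFin n) _ _) ⟩
      W + ∑[ x ∈ allFin n ] ∑[ y ∈ allFin n ] ∑[ v ∈ tuples n m ] err y x v
        ≡⟨ cong (W +_) (∑-swap (allFin n) (allFin n) _) ⟩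
      W + W
        ≡⟨ cong (W +_) (+-identityʳ W) ⟨
      2 * W
        ≡⟨ cong (2 *_) (∑-cong (allFin n) λ x → ∑-tuples n m
             λ v → ⟦ φ (⁅ x ⁆ ∪ support v) xor (ψ (support v) xor g x) ⟧) ⟨
      2 * sum-error (suc m) g φ ψ ∎
      where
      err : Fin n → Fin n → Vec (Fin n) m → ℕ
      err x y v = ⟦ φ (⁅ x ⁆ ∪ support (y ∷ v)) xor (ψ (support (y ∷ v)) xor g x) ⟧

      W : ℕ
      W = ∑[ x ∈ allFin n ] ∑[ y ∈ allFin n ] ∑[ v ∈ tuples n m ] err x y v

      cancel : ∀ f p q a b → p xor ((q xor a) xor b) ≡ (f xor (p xor a)) xor (f xor (q xor b))
      cancel = solve 5 (λ f p q a b → p :+ ((q :+ a) :+ b) := (f :+ (p :+ a)) :+ (f :+ (q :+ b))) refl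
        where open xor-∧-Solver

      pointwise : ∀ x y v → ⟦ ψ (⁅ y ⁆ ∪ support v) xor (shift g ψ x (support v) xor g y) ⟧ ≤ err x y v + err y x v
      pointwise x y v = ⟦⟧-triangle _ (φ (⁅ y ⁆ ∪ support (x ∷ v)) xor (ψ (support (x ∷ v)) xor g y)) (trans
        (cancel (φ (⁅ x ⁆ ∪ support (y ∷ v))) (ψ (support (y ∷ v))) (ψ (support (x ∷ v))) (g x) (g y))
        (cong (λ S → (φ (⁅ x ⁆ ∪ support (y ∷ v)) xor (ψ (support (y ∷ v)) xor g x)) xor (φ S xor (ψ (support (x ∷ v)) xor g y)))
          (∪-exchange ⁅ x ⁆ ⁅ y ⁆ (support v))))

    -- Induction on the length: for an averaged b, the pair `ψ`, `shift g ψ b` satisfies the same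
    -- relation one entry shorter with error at most 2W/n. Summing over the n choices of x restores
    -- the factor n, for a total of at most W + 2 · 3^m · W.
    affine : ∀ m g φ ψ → ∃[ c ] affine-error (suc m) g φ c ≤ 3 ^ m * sum-error m g φ ψ
    -- Only the empty tuple is left for `ψ`, so its value there is the constant.
    affine zero g φ ψ = ψ ∅ , (begin
      affine-error 1 g φ (ψ ∅)
        ≡⟨ ∑-tuples n 0 (λ v → ⟦ φ (support v) xor (ψ ∅ xor sumᵇ g v) ⟧) ⟩
      ∑[ x ∈ allFin n ] ∑[ v ∈ tuples n 0 ] ⟦ φ (support (x ∷ v)) xor (ψ ∅ xor sumᵇ g (x ∷ v)) ⟧
        ≡⟨ ∑-cong (allFin n) (λ x → cong (λ b → ⟦ φ (⁅ x ⁆ ∪ ∅) xor (ψ ∅ xor b) ⟧ + 0) (xor-identityʳ (g x))) ⟩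
      sum-error 0 g φ ψ
        ≡⟨ +-identityʳ _ ⟨
      1 * sum-error 0 g φ ψ ∎)
    affine (suc m) g φ ψ =
      let b , n*error≤2W = ∑-average (allFin n) 0<∣allFin∣ (shift-error m g φ ψ)
          c , error≤     = affine m g ψ (shift g ψ b)
      in c , bound b c n*error≤2W error≤
      where
      N W : ℕ
      N = length (allFin n)
      W = sum-error (suc m) g φ ψ

      cancel : ∀ f p c a s → f xor (c xor (a xor s)) ≡ (f xor (p xor a)) xor (p xor (c xor s))
      cancel = solve 5 (λ f p c a s → f :+ (c :+ (a :+ s)) := (f :+ (p :+ a)) :+ (p :+ (c :+ s))) refl
        where open xor-∧-Solver

      exchange : ∀ a b c → a * (b * c) ≡ b * (a * c)
      exchange = solve-∀

      collect : ∀ a w → a * w + a * (2 * w) ≡ 3 * a * w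
      collect = solve-∀

      bound : ∀ b c → N * sum-error m g ψ (shift g ψ b) ≤ 2 * W →
              affine-error (suc m) g ψ c ≤ 3 ^ m * sum-error m g ψ (shift g ψ b) →
              affine-error (2 + m) g φ c ≤ 3 ^ suc m * W
      bound b c n*error≤2W error≤ = begin
        affine-error (2 + m) g φ c
          ≡⟨ ∑-tuples n (suc m) (λ v → ⟦ φ (support v) xor (c xor sumᵇ g v) ⟧) ⟩
        ∑[ x ∈ allFin n ] ∑[ v ∈ tuples n (suc m) ] ⟦ φ (support (x ∷ v)) xor (c xor sumᵇ g (x ∷ v)) ⟧
          ≤⟨ ∑-mono (allFin n) (λ x → ∑-mono (tuples n (suc m)) λ v →
               ⟦⟧-triangle (φ (support (x ∷ v)) xor (ψ (support v) xor g x)) _ (cancel (φ (support (x ∷ v))) (ψ (support v)) c (g x) (sumᵇ g v))) ⟩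
        ∑[ x ∈ allFin n ] ∑[ v ∈ tuples n (suc m) ]
          (⟦ φ (⁅ x ⁆ ∪ support v) xor (ψ (support v) xor g x) ⟧ + ⟦ ψ (support v) xor (c xor sumᵇ g v) ⟧)
          ≡⟨ trans (∑-cong (allFin n) λ x → ∑-+ (tuples n (suc m)) _ _) (∑-+ (allFin n) _ _) ⟩
        W + ∑[ x ∈ allFin n ] affine-error (suc m) g ψ c
          ≡⟨ cong (W +_) (∑-const (allFin n) _) ⟩
        W + N * affine-error (suc m) g ψ c
          ≤⟨ +-monoʳ-≤ W (*-monoʳ-≤ N error≤) ⟩
        W + N * (3 ^ m * sum-error m g ψ (shift g ψ b))
          ≡⟨ cong (W +_) (exchange N (3 ^ m) _) ⟩
        W + 3 ^ m * (N * sum-error m g ψ (shift g ψ b))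
          -- Enlarging W to 3^m W turns the factor 1 + 2 · 3^m into 3^(m+1).
          ≤⟨ +-mono-≤ (m≤n*m W (3 ^ m) {{m^n≢0 3 m}}) (*-monoʳ-≤ (3 ^ m) n*error≤2W) ⟩
        3 ^ m * W + 3 ^ m * (2 * W)
          ≡⟨ collect (3 ^ m) W ⟩
        3 ^ suc m * W ∎

    module _ (m : ℕ) (h φ : Subset n → Bool) where

      k : ℕ
      k = suc m

      split-error : ℕ
      split-error = ∑[ p ∈ tuples n k ] ∑[ q ∈ tuples n k ]
        ⟦ h (support p ∪ support q) xor (φ (support p) xor φ (support q)) ⟧

      -- The effect on `φ` of exchanging a for x next to w. For `φ` = c + Σ g it equals g x - g a,
      -- and the offset k · g a is absorbed by the constant.
      slope : Fin n → Vec (Fin n) m → Fin n → Bool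
      slope a w x = φ (⁅ x ⁆ ∪ support w) xor φ (⁅ a ⁆ ∪ support w)

      -- Splitting the set x v a w both as x v | a w and as x w | a v gives
      -- φ(x v) + φ(a w) = φ(x w) + φ(a v).
      slope-error : ∑[ a ∈ allFin n ] ∑[ w ∈ tuples n m ] sum-error m (slope a w) φ (λ S → φ (⁅ a ⁆ ∪ S)) ≤ 2 * split-error
      slope-error = begin
        ∑[ a ∈ allFin n ] ∑[ w ∈ tuples n m ] sum-error m (slope a w) φ (λ S → φ (⁅ a ⁆ ∪ S))
          ≤⟨ ∑-mono (allFin n) (λ a → ∑-mono (tuples n m) λ w → ∑-mono (allFin n) λ x → ∑-mono (tuples n m) λ v → pointwise a w x v) ⟩
        ∑[ a ∈ allFin n ] ∑[ w ∈ tuples n m ] ∑[ x ∈ allFin n ] ∑[ v ∈ tuples n m ] (err (x ∷ v) (a ∷ w) + err (x ∷ w) (a ∷ v))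
          ≡⟨ trans (∑-cong (allFin n) λ a → trans (∑-cong (tuples n m) λ w → trans (∑-cong (allFin n) λ x →
               ∑-+ (tuples n m) _ _) (∑-+ (allFin n) _ _)) (∑-+ (tuples n m) _ _)) (∑-+ (allFin n) _ _) ⟩
        ∑[ a ∈ allFin n ] ∑[ w ∈ tuples n m ] ∑[ x ∈ allFin n ] ∑[ v ∈ tuples n m ] err (x ∷ v) (a ∷ w) +
        ∑[ a ∈ allFin n ] ∑[ w ∈ tuples n m ] ∑[ x ∈ allFin n ] ∑[ v ∈ tuples n m ] err (x ∷ w) (a ∷ v)
          ≡⟨ cong₂ _+_ first second ⟩
        split-error + split-error
          ≡⟨ cong (split-error +_) (+-identityʳ split-error) ⟨
        2 * split-error ∎
        where
        err : Vec (Fin n) k → Vec (Fin n) k → ℕ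
        err p q = ⟦ h (support p ∪ support q) xor (φ (support p) xor φ (support q)) ⟧

        first : ∑[ a ∈ allFin n ] ∑[ w ∈ tuples n m ] ∑[ x ∈ allFin n ] ∑[ v ∈ tuples n m ] err (x ∷ v) (a ∷ w) ≡ split-error
        first = begin-equality
          ∑[ a ∈ allFin n ] ∑[ w ∈ tuples n m ] ∑[ x ∈ allFin n ] ∑[ v ∈ tuples n m ] err (x ∷ v) (a ∷ w)
            ≡⟨ ∑-cong (allFin n) (λ a → ∑-cong (tuples n m) λ w → ∑-tuples n m λ p → err p (a ∷ w)) ⟨
          ∑[ a ∈ allFin n ] ∑[ w ∈ tuples n m ] ∑[ p ∈ tuples n k ] err p (a ∷ w)
            ≡⟨ ∑-tuples n m (λ q → ∑[ p ∈ tuples n k ] err p q) ⟨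
          ∑[ q ∈ tuples n k ] ∑[ p ∈ tuples n k ] err p q
            ≡⟨ ∑-swap (tuples n k) (tuples n k) (λ q p → err p q) ⟩
          split-error ∎

        -- Here x goes with w and a with v, so the sums are reordered before the two tuples can be
        -- reassembled.
        second : ∑[ a ∈ allFin n ] ∑[ w ∈ tuples n m ] ∑[ x ∈ allFin n ] ∑[ v ∈ tuples n m ] err (x ∷ w) (a ∷ v) ≡ split-error
        second = begin-equality
          ∑[ a ∈ allFin n ] ∑[ w ∈ tuples n m ] ∑[ x ∈ allFin n ] ∑[ v ∈ tuples n m ] err (x ∷ w) (a ∷ v)
            ≡⟨ ∑-cong (allFin n) (λ a → ∑-swap (tuples n m) (allFin n) _) ⟩
          ∑[ a ∈ allFin n ] ∑[ x ∈ allFin n ] ∑[ w ∈ tuples n m ] ∑[ v ∈ tuples n m ] err (x ∷ w) (a ∷ v)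
            ≡⟨ ∑-swap (allFin n) (allFin n) _ ⟩
          ∑[ x ∈ allFin n ] ∑[ a ∈ allFin n ] ∑[ w ∈ tuples n m ] ∑[ v ∈ tuples n m ] err (x ∷ w) (a ∷ v)
            ≡⟨ ∑-cong (allFin n) (λ x → ∑-swap (allFin n) (tuples n m) _) ⟩
          ∑[ x ∈ allFin n ] ∑[ w ∈ tuples n m ] ∑[ a ∈ allFin n ] ∑[ v ∈ tuples n m ] err (x ∷ w) (a ∷ v)
            ≡⟨ ∑-cong (allFin n) (λ x → ∑-cong (tuples n m) λ w → ∑-tuples n m (err (x ∷ w))) ⟨
          ∑[ x ∈ allFin n ] ∑[ w ∈ tuples n m ] ∑[ q ∈ tuples n k ] err (x ∷ w) q
            ≡⟨ ∑-tuples n m (λ p → ∑[ q ∈ tuples n k ] err p q) ⟨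
          split-error ∎

        cancel : ∀ h p q r s → p xor (s xor (r xor q)) ≡ (h xor (p xor q)) xor (h xor (r xor s))
        cancel = solve 5 (λ h p q r s → p :+ (s :+ (r :+ q)) := (h :+ (p :+ q)) :+ (h :+ (r :+ s))) refl
          where open xor-∧-Solver

        pointwise : ∀ a w x v → ⟦ φ (⁅ x ⁆ ∪ support v) xor (φ (⁅ a ⁆ ∪ support v) xor slope a w x) ⟧
                                ≤ err (x ∷ v) (a ∷ w) + err (x ∷ w) (a ∷ v)
        pointwise a w x v = ⟦⟧-triangle _ (h (support (x ∷ w) ∪ support (a ∷ v)) xor dev) (trans
          (cancel (h (support (x ∷ v) ∪ support (a ∷ w))) (φ (support (x ∷ v))) (φ (support (a ∷ w))) (φ (support (x ∷ w))) (φ (support (a ∷ v))))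
          (cong (λ S → (h (support (x ∷ v) ∪ support (a ∷ w)) xor (φ (support (x ∷ v)) xor φ (support (a ∷ w)))) xor (h S xor dev))
            (∪-swap-last ⁅ x ⁆ (support v) ⁅ a ⁆ (support w))))
          where
          dev : Bool
          dev = φ (support (x ∷ w)) xor φ (support (a ∷ v))

      -- Replacing `φ` by c + Σ g in both halves cancels the two constants c and costs the affine
      -- error once per half. For a and w no worse than average, each half costs at most 3^m · 2
      -- `split-error`, whence 1 + 4 · 3^m.
      linear : ∃[ g ] ∑[ p ∈ tuples n k ] ∑[ q ∈ tuples n k ] ⟦ h (support p ∪ support q) xor (sumᵇ g p xor sumᵇ g q) ⟧
                      ≤ (1 + 4 * 3 ^ m) * split-error
      linear =
        let a , n*error≤  = ∑-average (allFin n) 0<∣allFin∣ slope-error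
            -- The bound is the sum over w itself, so that this average composes with the one over
            -- a.
            w , nᵐ*error≤ = ∑-average (tuples n m) {λ w → sum-error m (slope a w) φ (λ S → φ (⁅ a ⁆ ∪ S))} (0<∣tuples∣ m) ≤-refl
            c , error≤    = affine m (slope a w) φ (λ S → φ (⁅ a ⁆ ∪ S))
        in slope a w , Bound.bound a w c
             (≤-trans (*-monoʳ-≤ (length (allFin n)) nᵐ*error≤) n*error≤) error≤
        where
        module Bound (a : Fin n) (w : Vec (Fin n) m) (c : Bool) where
          g : Fin n → Bool
          g = slope a w

          dev : Vec (Fin n) k → ℕ
          dev p = ⟦ φ (support p) xor (c xor sumᵇ g p) ⟧

          M Z W : ℕ
          M = length (tuples n k)
          Z = affine-error k g φ c
          W = sum-error m g φ (λ S → φ (⁅ a ⁆ ∪ S))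

          ∑dev+dev : ∑[ p ∈ tuples n k ] ∑[ q ∈ tuples n k ] (dev p + dev q) ≡ M * Z + M * Z
          ∑dev+dev = trans (trans (∑-cong (tuples n k) λ p → ∑-+ (tuples n k) _ _) (∑-+ (tuples n k) _ _))
            (cong₂ _+_ (trans (∑-cong (tuples n k) λ p → ∑-const (tuples n k) (dev p)) (∑-*ˡ (tuples n k) M dev)) (∑-const (tuples n k) Z))

          MZ≤ : length (allFin n) * (length (tuples n m) * W) ≤ 2 * split-error → Z ≤ 3 ^ m * W →
                M * Z ≤ 3 ^ m * (2 * split-error)
          MZ≤ W≤ Z≤ = begin
            M * Z
              ≤⟨ *-monoʳ-≤ M Z≤ ⟩
            M * (3 ^ m * W)
              ≡⟨ cong (_* (3 ^ m * W)) (trans (length-tuples n k)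
                   (sym (cong₂ _*_ (length-allFin n) (length-tuples n m)))) ⟩
            length (allFin n) * length (tuples n m) * (3 ^ m * W)
              ≡⟨ exchange (length (allFin n)) (length (tuples n m)) (3 ^ m) W ⟩
            3 ^ m * (length (allFin n) * (length (tuples n m) * W))
              ≤⟨ *-monoʳ-≤ (3 ^ m) W≤ ⟩
            3 ^ m * (2 * split-error) ∎
            where
            exchange : ∀ a b c d → a * b * (c * d) ≡ c * (a * (b * d))
            exchange = solve-∀

          cancel : ∀ h p q c s t → h xor (s xor t) ≡ (h xor (p xor q)) xor ((p xor (c xor s)) xor (q xor (c xor t)))
          cancel = solve 6 (λ h p q c s t → h :+ (s :+ t) := (h :+ (p :+ q)) :+ ((p :+ (c :+ s)) :+ (q :+ (c :+ t)))) refl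
            where open xor-∧-Solver

          pointwise : ∀ p q → ⟦ h (support p ∪ support q) xor (sumᵇ g p xor sumᵇ g q) ⟧
                      ≤ ⟦ h (support p ∪ support q) xor (φ (support p) xor φ (support q)) ⟧ + (dev p + dev q)
          pointwise p q = ≤-trans
            (⟦⟧-triangle (h (support p ∪ support q) xor (φ (support p) xor φ (support q))) (d p xor d q)
              (cancel (h (support p ∪ support q)) (φ (support p)) (φ (support q)) c (sumᵇ g p) (sumᵇ g q)))
            (+-monoʳ-≤ ⟦ h (support p ∪ support q) xor (φ (support p) xor φ (support q)) ⟧ (⟦xor⟧-subadditive (d p) (d q)))
            where
            d : Vec (Fin n) k → Bool
            d p = φ (support p) xor (c xor sumᵇ g p)

          collect : ∀ a v → v + (a * (2 * v) + a * (2 * v)) ≡ (1 + 4 * a) * v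
          collect = solve-∀

          bound : length (allFin n) * (length (tuples n m) * W) ≤ 2 * split-error → Z ≤ 3 ^ m * W →
                  ∑[ p ∈ tuples n k ] ∑[ q ∈ tuples n k ] ⟦ h (support p ∪ support q) xor (sumᵇ g p xor sumᵇ g q) ⟧
                  ≤ (1 + 4 * 3 ^ m) * split-error
          bound W≤ Z≤ = begin
            ∑[ p ∈ tuples n k ] ∑[ q ∈ tuples n k ] ⟦ h (support p ∪ support q) xor (sumᵇ g p xor sumᵇ g q) ⟧
              ≤⟨ ∑-mono (tuples n k) (λ p → ∑-mono (tuples n k) λ q → pointwise p q) ⟩
            ∑[ p ∈ tuples n k ] ∑[ q ∈ tuples n k ]
              (⟦ h (support p ∪ support q) xor (φ (support p) xor φ (support q)) ⟧ + (dev p + dev q))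
              ≡⟨ trans (∑-cong (tuples n k) λ p → ∑-+ (tuples n k) _ _) (∑-+ (tuples n k) _ _) ⟩
            split-error + ∑[ p ∈ tuples n k ] ∑[ q ∈ tuples n k ] (dev p + dev q)
              ≡⟨ cong (split-error +_) ∑dev+dev ⟩
            split-error + (M * Z + M * Z)
              ≤⟨ +-monoʳ-≤ split-error (+-mono-≤ (MZ≤ W≤ Z≤) (MZ≤ W≤ Z≤)) ⟩
            split-error + (3 ^ m * (2 * split-error) + 3 ^ m * (2 * split-error))
              ≡⟨ collect (3 ^ m) split-error ⟩
            (1 + 4 * 3 ^ m) * split-error ∎

  -- Hypergraphs without 𝒞₃

  does-true : {P : Set} (P? : Dec P) → does P? ≡ true → P
  does-true (yes p) _ = p

  ∑-tuples-split : ∀ {n r} l m (f : ∀ {r} → Vec (Fin n) r → ℕ) → r ≡ l + m →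
                   ∑ (tuples n r) f ≡ ∑[ v ∈ tuples n l ] ∑[ w ∈ tuples n m ] f (v Vec.++ w)
  ∑-tuples-split l m f refl = ∑-tuples-++ l m f

  2k≡k+k : ∀ k → 2 * k ≡ k + k
  2k≡k+k k = cong (k +_) (+-identityʳ k)

  ∣∩∣+∣∩∁∣ : ∀ {n} (S T : Subset n) → ∣ S ∩ T ∣ + ∣ S ∩ ∁ T ∣ ≡ ∣ S ∣
  ∣∩∣+∣∩∁∣ []          []          = refl
  ∣∩∣+∣∩∁∣ (true  ∷ S) (true  ∷ T) = cong suc (∣∩∣+∣∩∁∣ S T)
  ∣∩∣+∣∩∁∣ (true  ∷ S) (false ∷ T) = trans (+-suc _ _) (cong suc (∣∩∣+∣∩∁∣ S T))
  ∣∩∣+∣∩∁∣ (false ∷ S) (_     ∷ T) = ∣∩∣+∣∩∁∣ S T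

  module Core (m n : ℕ) .{{_ : NonZero n}} (H : Hypergraph (2 * suc m) n) (𝒞₃-free : ¬ CopyOf𝒞₃ (suc m) H) where

    open Linearisation n using (linear)
    open ≤-Reasoning

    k : ℕ
    k = suc m

    h : Subset n → Bool
    h S = does (edge? H S)

    G : Vec (Fin n) k → Vec (Fin n) k → Bool
    G p q = h (support p ∪ support q)

    G-sym : ∀ p q → G p q ≡ G q p
    G-sym p q = cong h (∪-comm (support p) (support q))

    triangle-free : ∀ {p q r} → G p q ≡ true → G q r ≡ true → G r p ≡ true → ⊥
    triangle-free {p} {q} {r} pq qr rp = 𝒞₃-free record
      { P₁     = support p
      ; P₂     = support q
      ; P₃     = support r
      ; size₁  = proj₁ p-q
      ; size₂  = proj₁ q-r
      ; size₃  = proj₁ r-p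
      ; disj₁₂ = proj₂ p-q
      ; disj₂₃ = proj₂ q-r
      ; disj₃₁ = proj₂ r-p
      ; edge₁₂ = does-true (edge? H _) pq
      ; edge₂₃ = does-true (edge? H _) qr
      ; edge₃₁ = does-true (edge? H _) rp
      }
      where
      full : ∀ p q → G p q ≡ true → ∣ support p ∣ ≡ k × Empty (support p ∩ support q)
      full p q pq = union-of-full-size (∣support∣≤ p) (∣support∣≤ q) (uniform H (does-true (edge? H _) pq))
      p-q = full p q pq
      q-r = full q r qr
      r-p = full r p rp

    open TriangleFree (tuples n k) G G-sym (λ {p} {q} {r} → triangle-free {p} {q} {r}) using (M; E; stability)

    M²≡n^2k : M * M ≡ n ^ (2 * k)
    M²≡n^2k = begin-equality
      M * M          ≡⟨ cong₂ _*_ (length-tuples n k) (length-tuples n k) ⟩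
      n ^ k * n ^ k  ≡⟨ ^-distribˡ-+-* n k k ⟨
      n ^ (k + k)    ≡⟨ cong (n ^_) (2k≡k+k k) ⟨
      n ^ (2 * k)    ∎

    -- Cutting each of the (2k)! enumerations of an edge of `H` in the middle gives an ordered edge
    -- of `G`.
    edges≤E : (2 * k) ! * e H ≤ E
    edges≤E = begin
      (2 * k) ! * e H
        ≡⟨ cong ((2 * k) ! *_) (#subsets≡∑ (edge? H)) ⟩
      (2 * k) ! * ∑[ S ∈ subsets n ] ⟦ h S ⟧
        ≤⟨ ∑-subsets≤∑-tuples (2 * k) (λ S → ⟦ h S ⟧) non-edge ⟩
      ∑[ v ∈ tuples n (2 * k) ] ⟦ h (support v) ⟧
        ≡⟨ ∑-tuples-split k k (λ v → ⟦ h (support v) ⟧) (2k≡k+k k) ⟩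
      ∑[ p ∈ tuples n k ] ∑[ q ∈ tuples n k ] ⟦ h (support (p Vec.++ q)) ⟧
        ≡⟨ ∑-cong (tuples n k) (λ p → ∑-cong (tuples n k) λ q → cong (λ S → ⟦ h S ⟧) (support-++ p q)) ⟩
      E ∎
      where
      non-edge : ∀ S → ∣ S ∣ ≢ 2 * k → ⟦ h S ⟧ ≡ 0
      non-edge S ∣S∣≢2k with edge? H S
      ... | yes edge = ⊥-elim (∣S∣≢2k (uniform H edge))
      ... | no _     = refl

    module _ (g : Fin n → Bool) where

      V₁ V₂ : Subset n
      V₁ = Vec.tabulate g
      V₂ = ∁ V₁

      partition : IsPartition V₁ V₂
      partition = (λ (x , x∈) → let x∈V₁ , x∈V₂ = x∈p∩q⁻ V₁ V₂ x∈ in x∈∁p⇒x∉p x∈V₂ x∈V₁) , p∪∁p≡⊤ V₁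

      inc : Subset n → Bool
      inc S = does (incorrect? V₁ V₂ H S)

      inc-size : ∀ S → ∣ S ∣ ≢ 2 * k → inc S ≡ false
      inc-size S ∣S∣≢2k = cong (_∧ not (does (correct? V₁ V₂ H S))) (dec-false (∣ S ∣ ≟ 2 * k) ∣S∣≢2k)

      -- A support of the wrong size is never incorrect. At full size the intersections with `V₁`
      -- and `V₂` add up to the even number 2k, so their parities agree: the set is good exactly
      -- when Σ g = 1, and incorrect exactly when this differs from membership in `H`.
      inc-support : ∀ v → ⟦ inc (support v) ⟧ ≤ ⟦ h (support {m = 2 * k} v) xor sumᵇ g v ⟧
      inc-support v with ∣ support v ∣ ≟ 2 * k
      ... | no  ¬full = ≤-trans (≤-reflexive (cong ⟦_⟧ (inc-size (support v) ¬full))) z≤n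
      ... | yes full  = ≤-reflexive (cong ⟦_⟧ (trans
        (cong (_∧ not (does (correct? V₁ V₂ H S))) (dec-true (∣ S ∣ ≟ 2 * k) full))
        (bits (odd ∣ S ∩ V₁ ∣) (odd ∣ S ∩ V₂ ∣) (h S) (sumᵇ g v) o₁≡sum o₁≡o₂)))
        where
        S : Subset n
        S = support v

        bits : ∀ o₁ o₂ e b → o₁ ≡ b → o₁ ≡ o₂ → not (((o₁ ∧ o₂) ∧ e) ∨ (not (o₁ ∧ o₂) ∧ not e)) ≡ e xor b
        bits true  true  true  true  refl refl = refl
        bits true  true  false true  refl refl = refl
        bits false false true  false refl refl = refl
        bits false false false false refl refl = refl

        o₁≡sum : odd ∣ S ∩ V₁ ∣ ≡ sumᵇ g v
        o₁≡sum = odd-∩ g v full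

        xor-false : ∀ a b → a xor b ≡ false → a ≡ b
        xor-false true  true  _ = refl
        xor-false false false _ = refl

        odd-double : ∀ l → odd (l + l) ≡ false
        odd-double l = trans (odd-+ l l) (xor-same (odd l))

        o₁≡o₂ : odd ∣ S ∩ V₁ ∣ ≡ odd ∣ S ∩ V₂ ∣
        o₁≡o₂ = xor-false _ _ (trans (sym (odd-+ ∣ S ∩ V₁ ∣ _))
          (trans (cong odd (trans (∣∩∣+∣∩∁∣ S V₁) (trans full (2k≡k+k k)))) (odd-double k)))

      #incorrect≤ : #incorrect V₁ V₂ H ≤
                    ∑[ p ∈ tuples n k ] ∑[ q ∈ tuples n k ] ⟦ h (support p ∪ support q) xor (sumᵇ g p xor sumᵇ g q) ⟧
      #incorrect≤ = begin
        #incorrect V₁ V₂ H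
          -- The constant factor (2k)! is given away here.
          ≤⟨ m≤n*m _ ((2 * k) !) {{(2 * k) !≢0}} ⟩
        (2 * k) ! * #incorrect V₁ V₂ H
          ≡⟨ cong ((2 * k) ! *_) (#subsets≡∑ (incorrect? V₁ V₂ H)) ⟩
        (2 * k) ! * ∑[ S ∈ subsets n ] ⟦ inc S ⟧
          ≤⟨ ∑-subsets≤∑-tuples (2 * k) (λ S → ⟦ inc S ⟧) (λ S ∣S∣≢2k → cong ⟦_⟧ (inc-size S ∣S∣≢2k)) ⟩
        ∑[ v ∈ tuples n (2 * k) ] ⟦ inc (support v) ⟧
          ≤⟨ ∑-mono (tuples n (2 * k)) inc-support ⟩
        ∑[ v ∈ tuples n (2 * k) ] ⟦ h (support v) xor sumᵇ g v ⟧
          ≡⟨ ∑-tuples-split k k (λ v → ⟦ h (support v) xor sumᵇ g v ⟧) (2k≡k+k k) ⟩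
        ∑[ p ∈ tuples n k ] ∑[ q ∈ tuples n k ] ⟦ h (support (p Vec.++ q)) xor sumᵇ g (p Vec.++ q) ⟧
          ≡⟨ ∑-cong (tuples n k) (λ p → ∑-cong (tuples n k) λ q →
               cong₂ (λ S b → ⟦ h S xor b ⟧) (support-++ p q) (sumᵇ-++ g p q)) ⟩
        ∑[ p ∈ tuples n k ] ∑[ q ∈ tuples n k ] ⟦ h (support p ∪ support q) xor (sumᵇ g p xor sumᵇ g q) ⟧ ∎

    few-incorrect : ∀ D → n ^ (2 * k) ≤ 2 * ((2 * k) ! * e H) + D →
                    ∃[ V₁ ] ∃[ V₂ ] (IsPartition V₁ V₂ × #incorrect V₁ V₂ H ≤ (1 + 4 * 3 ^ m) * 9 * D)
    few-incorrect D dense =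
      -- The fallback is the tuple repeating vertex 0, which exists since n is nonzero.
      let u , 2V≤9D  = stability (Vec.replicate k (fromℕ< (>-nonZero⁻¹ n))) M²≤
          -- With this choice `φ (support p)` is `G p u`, so `split-error` is the number of
          -- mismatches of `u`.
          g , linear≤ = linear m h (λ S → h (S ∪ support u))
      in V₁ g , V₂ g , partition g , ≤-trans (#incorrect≤ g) (≤-trans linear≤
           (≤-trans (*-monoʳ-≤ (1 + 4 * 3 ^ m) (≤-trans (m≤m+n _ _) 2V≤9D)) (≤-reflexive (sym (*-assoc (1 + 4 * 3 ^ m) 9 D)))))
      where
      M²≤ : M * M ≤ 2 * E + D
      M²≤ = begin
        M * M                         ≡⟨ M²≡n^2k ⟩
        n ^ (2 * k)                   ≤⟨ dense ⟩
        2 * ((2 * k) ! * e H) + D     ≤⟨ +-monoˡ-≤ D (*-monoʳ-≤ 2 edges≤E) ⟩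
        2 * E + D                     ∎

  -- Binomial coefficients against powers.

  [k+1]!nC[k+1] : ∀ n k → suc k ! * (n C suc k) ≡ (n ∸ k) * (k ! * (n C k))
  [k+1]!nC[k+1] n k with k <? n
  ... | no  k≮n = trans (cong (suc k ! *_) (k>n⇒nCk≡0 (s≤s (≮⇒≥ k≮n)))) (trans (*-zeroʳ (suc k !))
                    (cong (_* (k ! * (n C k))) (sym (m≤n⇒m∸n≡0 (≮⇒≥ k≮n)))))
  ... | yes k<n = *-cancelʳ-≡ _ _ ((n ∸ suc k) !) {{(n ∸ suc k) !≢0}} (begin
    suc k ! * (n C suc k) * (n ∸ suc k) !
      ≡⟨ rotate (suc k !) (n C suc k) ((n ∸ suc k) !) ⟩
    (n C suc k) * (suc k ! * (n ∸ suc k) !)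
      ≡⟨ C-spec k<n ⟩
    n !
      ≡⟨ C-spec (<⇒≤ k<n) ⟨
    (n C k) * (k ! * (n ∸ k) !)
      ≡⟨ cong (λ f → (n C k) * (k ! * f)) (sym ([n-k]*[n-k-1]!≡[n-k]! k<n)) ⟩
    (n C k) * (k ! * ((n ∸ k) * (n ∸ suc k) !))
      ≡⟨ rotate′ (n C k) (k !) (n ∸ k) ((n ∸ suc k) !) ⟩
    (n ∸ k) * (k ! * (n C k)) * (n ∸ suc k) ! ∎)
    where
    open ≡-Reasoning
    C-spec : ∀ {j} → j ≤ n → (n C j) * (j ! * (n ∸ j) !) ≡ n !
    C-spec {j} j≤n = trans (cong (_* (j ! * (n ∸ j) !)) (nCk≡n!/k![n-k]! j≤n))
      (m/n*n≡m {{j !* (n ∸ j) !≢0}} (k![n∸k]!∣n! j≤n))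
    rotate : ∀ a b c → a * b * c ≡ b * (a * c)
    rotate = solve-∀
    rotate′ : ∀ a b c d → a * (b * (c * d)) ≡ c * (b * a) * d
    rotate′ = solve-∀

  k!nCk≤n^k : ∀ n k → k ! * (n C k) ≤ n ^ k
  k!nCk≤n^k n zero    = ≤-reflexive (+-identityʳ _)
  k!nCk≤n^k n (suc k) = ≤-trans (≤-reflexive ([k+1]!nC[k+1] n k)) (*-mono-≤ (m∸n≤m n k) (k!nCk≤n^k n k))

  -- `k ! * (n C k)` is the falling factorial n(n-1)...(n-k+1). Its factors fall short of n by 0,
  -- ..., k-1, so the total loss is at most k² n^(k-1); the extra factor n avoids the exponent k -
  -- 1.
  n^[k+1]≤ : ∀ n k → n * n ^ k ≤ n * (k ! * (n C k)) + k * k * n ^ k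
  n^[k+1]≤ n zero    = ≤-reflexive (sym (+-identityʳ _))
  n^[k+1]≤ n (suc k) = begin
    n * (n * n ^ k)
      ≤⟨ *-monoʳ-≤ n (n^[k+1]≤ n k) ⟩
    n * (n * c + k * k * n ^ k)
      ≤⟨ *-monoʳ-≤ n (+-monoˡ-≤ _ (≤-trans (*-monoˡ-≤ c (≤-trans (m≤n+m∸n n k) (≤-reflexive (+-comm k _))))
           (≤-reflexive (*-distribʳ-+ c (n ∸ k) k)))) ⟩
    n * ((n ∸ k) * c + k * c + k * k * n ^ k)
      ≡⟨ cong (λ x → n * (x + k * c + k * k * n ^ k)) ([k+1]!nC[k+1] n k) ⟨
    n * (c′ + k * c + k * k * n ^ k)
      ≤⟨ *-monoʳ-≤ n (+-monoˡ-≤ (k * k * n ^ k) (+-monoʳ-≤ c′ (*-monoʳ-≤ k (k!nCk≤n^k n k)))) ⟩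
    n * (c′ + k * n ^ k + k * k * n ^ k)
      -- This pads k² + k to (k + 1)².
      ≤⟨ m≤m+n _ (n * ((1 + k) * n ^ k)) ⟩
    n * (c′ + k * n ^ k + k * k * n ^ k) + n * ((1 + k) * n ^ k)
      ≡⟨ rearrange n c′ k (n ^ k) ⟩
    n * c′ + suc k * suc k * (n * n ^ k) ∎
    where
    open ≤-Reasoning
    c c′ : ℕ
    c  = k ! * (n C k)
    c′ = suc k ! * (n C suc k)
    rearrange : ∀ n c k p → n * (c + k * p + k * k * p) + n * ((1 + k) * p) ≡ n * c + (1 + k) * (1 + k) * (n * p)
    rearrange = solve-∀

  -- Read `P` as n^r, `c` as the number of r-sets and `e` as the number of edges. The excess of `P`
  -- over 2 r! e has two sources: the density hypothesis loses at most 2 r! P / L, and passing from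
  -- r! c to `P` loses at most r² P / n. The choice of L and the lower bound on n make each at most
  -- P / (2dK).
  few-incorrect-dense : ∀ {n P c e} r K d .{{_ : NonZero n}} → let L = 4 * r ! * (d * K) in
    L * c ≤ 2 * L * e + 2 * P → n * P ≤ n * (r ! * c) + r * r * P → 2 * (d * K) * (r * r) ≤ n →
    d * (K * (P ∸ 2 * (r ! * e))) ≤ P
  few-incorrect-dense {n} {P} {c} {e} r K d Lc≤ nP≤ N≤n = *-cancelˡ-≤ (4 * r ! * n) {{m*n≢0 (4 * r !) n {{m*n≢0 4 (r !) {{_}} {{r !≢0}}}}}} (begin
    4 * r ! * n * (d * (K * D))
      ≡⟨ reassociate (4 * r !) n d K D ⟩
    L * n * D
      ≡⟨ *-distribˡ-∸ (L * n) P (2 * (r ! * e)) ⟩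
    L * n * P ∸ L * n * (2 * (r ! * e))
      ≤⟨ m≤n+o⇒m∸n≤o (L * n * P) (L * n * (2 * (r ! * e))) deficit ⟩
    (2 * r ! * n + L * (r * r)) * P
      ≤⟨ *-monoˡ-≤ P (+-monoʳ-≤ (2 * r ! * n) L*r²≤) ⟩
    (2 * r ! * n + 2 * r ! * n) * P
      ≡⟨ double (r !) n P ⟩
    4 * r ! * n * P ∎)
    where
    open ≤-Reasoning
    L D : ℕ
    L = 4 * r ! * (d * K)
    D = P ∸ 2 * (r ! * e)

    reassociate : ∀ a n d K D → a * n * (d * (K * D)) ≡ a * (d * K) * n * D
    reassociate = solve-∀

    double : ∀ f n P → (2 * f * n + 2 * f * n) * P ≡ 4 * f * n * P
    double = solve-∀

    L*r²≤ : L * (r * r) ≤ 2 * r ! * n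
    L*r²≤ = begin
      L * (r * r)                           ≡⟨ regroup (r !) (d * K) (r * r) ⟩
      2 * r ! * (2 * (d * K) * (r * r))     ≤⟨ *-monoʳ-≤ (2 * r !) N≤n ⟩
      2 * r ! * n                           ∎
      where
      regroup : ∀ f a b → 4 * f * a * b ≡ 2 * f * (2 * a * b)
      regroup = solve-∀

    deficit : L * n * P ≤ L * n * (2 * (r ! * e)) + (2 * r ! * n + L * (r * r)) * P
    deficit = begin
      L * n * P                                       ≡⟨ *-assoc L n P ⟩
      L * (n * P)                                     ≤⟨ *-monoʳ-≤ L nP≤ ⟩
      L * (n * (r ! * c) + r * r * P)                 ≡⟨ expand L n (r !) c (r * r * P) ⟩
      n * r ! * (L * c) + L * (r * r * P)             ≤⟨ +-monoˡ-≤ _ (*-monoʳ-≤ (n * r !) Lc≤) ⟩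
      n * r ! * (2 * L * e + 2 * P) + L * (r * r * P) ≡⟨ collect L n (r !) e P (r * r) ⟩
      L * n * (2 * (r ! * e)) + (2 * r ! * n + L * (r * r)) * P ∎
      where
      expand : ∀ L n f c x → L * (n * (f * c) + x) ≡ n * f * (L * c) + L * x
      expand = solve-∀
      collect : ∀ L n f e P s → n * f * (2 * L * e + 2 * P) + L * (s * P) ≡ L * n * (2 * (f * e)) + (2 * f * n + L * s) * P
      collect = solve-∀

  -- The choice of constants.

  module Scaled (m d : ℕ) .{{_ : NonZero d}} where

    -- `d` will be the denominator of ε and 1 / `scale` will be η; `K` is the factor lost in
    -- `few-incorrect`.
    r K scale threshold : ℕ
    r         = 2 * suc m
    K         = (1 + 4 * 3 ^ m) * 9
    scale     = 4 * r ! * (d * K)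
    -- The successor makes n nonzero.
    threshold = suc (2 * (d * K) * (r * r))

    scale≢0 : NonZero scale
    scale≢0 = m*n≢0 (4 * r !) (d * K) {{m*n≢0 4 (r !) {{_}} {{r !≢0}}}} {{m*n≢0 d K}}

    few-incorrect-scaled : ∀ {n} → threshold ≤ n → (H : Hypergraph r n) → ¬ CopyOf𝒞₃ (suc m) H →
      scale * (n C r) ≤ 2 * scale * e H + 2 * n ^ r →
      ∃[ V₁ ] ∃[ V₂ ] (IsPartition V₁ V₂ × d * #incorrect V₁ V₂ H ≤ n ^ r)
    few-incorrect-scaled {n} N≤n H free dense =
      -- The truncated difference is the least admissible deficit.
      let V₁ , V₂ , part , few = Core.few-incorrect m n H free (n ^ r ∸ 2 * (r ! * e H)) (m≤n+m∸n (n ^ r) (2 * (r ! * e H)))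
      in V₁ , V₂ , part , ≤-trans (*-monoʳ-≤ d few)
           (few-incorrect-dense r K d dense (n^[k+1]≤ n r) (≤-trans (n≤1+n _) N≤n))
      where
      instance
        n≢0 : NonZero n
        n≢0 = >-nonZero (≤-trans (s≤s z≤n) N≤n)

-- Passage between natural and rational numbers.

module Rationals where

  open import Data.Integer as ℤ using (+_; +[1+_]; -[1+_])
  import Data.Integer.Properties as ℤ
  open import Data.Nat as ℕ using (ℕ; zero; suc)
  import Data.Nat.Coprimality as Coprimality
  import Data.Nat.Properties as ℕ
  open import Data.Rational hiding (*≡*)
  open import Data.Rational.Properties
  open import Data.Rational.Solver using (module +-*-Solver)
  open import Data.Rational.Unnormalised using (mkℚᵘ; *≡*)
  open import Relation.Binary.PropositionalEquality

  -- `_/_` normalises by a gcd and is stuck on a variable numerator; in the form `mkℚ`, arithmetic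
  -- and order compute.
  fromℕ≡mkℚ : ∀ m → fromℕ m ≡ mkℚ (+ m) 0 (Coprimality.sym (Coprimality.1-coprimeTo m))
  fromℕ≡mkℚ m = normalize-coprime (Coprimality.sym (Coprimality.1-coprimeTo m))

  fromℕ-+ : ∀ a b → fromℕ a + fromℕ b ≡ fromℕ (a ℕ.+ b)
  fromℕ-+ a b = trans (cong₂ _+_ (fromℕ≡mkℚ a) (fromℕ≡mkℚ b))
    (cong (_/ 1) (cong₂ ℤ._+_ (ℤ.*-identityʳ (+ a)) (ℤ.*-identityʳ (+ b))))

  fromℕ-* : ∀ a b → fromℕ a * fromℕ b ≡ fromℕ (a ℕ.* b)
  fromℕ-* a b = trans (cong₂ _*_ (fromℕ≡mkℚ a) (fromℕ≡mkℚ b)) (cong (_/ 1) (sym (ℤ.pos-* a b)))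

  fromℕ-mono-≤ : ∀ {a b} → a ℕ.≤ b → fromℕ a ≤ fromℕ b
  fromℕ-mono-≤ {a} {b} a≤b = subst₂ _≤_ (sym (fromℕ≡mkℚ a)) (sym (fromℕ≡mkℚ b))
    (*≤* (subst₂ ℤ._≤_ (sym (ℤ.*-identityʳ (+ a))) (sym (ℤ.*-identityʳ (+ b))) (ℤ.+≤+ a≤b)))

  fromℕ-cancel-< : ∀ {a b} → fromℕ a < fromℕ b → a ℕ.< b
  fromℕ-cancel-< a<b = ℕ.≰⇒> λ b≤a → <-irrefl refl (<-≤-trans a<b (fromℕ-mono-≤ b≤a))

  fromℕ-positive : ∀ m .{{_ : ℕ.NonZero m}} → Positive (fromℕ m)
  fromℕ-positive (suc m) = subst Positive (sym (fromℕ≡mkℚ (suc m))) _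

  recip : (L : ℕ) .{{_ : ℕ.NonZero L}} → ℚ
  recip L = (1/ fromℕ L) {{pos⇒nonZero (fromℕ L) {{fromℕ-positive L}}}}

  recip-positive : ∀ L .{{_ : ℕ.NonZero L}} → 0ℚ < recip L
  recip-positive L = positive⁻¹ (recip L) {{1/pos⇒pos (fromℕ L) {{fromℕ-positive L}}}}

  -- Multiplication by 2L removes both ½ and 1/L, leaving an inequality between natural numbers once
  -- the negative term is moved across.
  clear-denominators : ∀ L .{{_ : ℕ.NonZero L}} c p e →
    ½ * fromℕ c - recip L * fromℕ p < fromℕ e → L ℕ.* c ℕ.≤ 2 ℕ.* L ℕ.* e ℕ.+ 2 ℕ.* p
  clear-denominators L c p e dense = ℕ.<⇒≤ (fromℕ-cancel-< (begin-strict
    fromℕ (L ℕ.* c)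
      ≡⟨ fromℕ-* L c ⟨
    l * fromℕ c
      ≡⟨ trans (sym (*-identityˡ _)) (cancel 1ℚ (l * fromℕ c) (two * fromℕ p)) ⟩
    1ℚ * (l * fromℕ c) - (two * fromℕ p) * 1ℚ + two * fromℕ p
      -- `two * ½` computes to `1ℚ`, so only `l * η` needs rewriting.
      ≡⟨ cong (λ x → 1ℚ * (l * fromℕ c) - (two * fromℕ p) * x + two * fromℕ p)
           (*-inverseʳ l {{pos⇒nonZero l {{fromℕ-positive L}}}}) ⟨
    two * ½ * (l * fromℕ c) - (two * fromℕ p) * (l * η) + two * fromℕ p
      ≡⟨ cong (_+ two * fromℕ p) (expand two ½ l η (fromℕ c) (fromℕ p)) ⟨
    two * l * (½ * fromℕ c - η * fromℕ p) + two * fromℕ p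
      <⟨ +-monoˡ-< (two * fromℕ p) (*-monoʳ-<-pos (two * l) {{pos*pos⇒pos two l {{fromℕ-positive L}}}} dense) ⟩
    two * l * fromℕ e + two * fromℕ p
      ≡⟨ cong₂ _+_ (trans (cong (_* fromℕ e) (fromℕ-* 2 L)) (fromℕ-* (2 ℕ.* L) e)) (fromℕ-* 2 p) ⟩
    fromℕ (2 ℕ.* L ℕ.* e) + fromℕ (2 ℕ.* p)
      ≡⟨ fromℕ-+ (2 ℕ.* L ℕ.* e) (2 ℕ.* p) ⟩
    fromℕ (2 ℕ.* L ℕ.* e ℕ.+ 2 ℕ.* p) ∎))
    where
    open ≤-Reasoning
    two l η : ℚ
    two = fromℕ 2
    l   = fromℕ L
    η   = recip L

    cancel : ∀ o x y → o * x ≡ o * x - y * 1ℚ + y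
    cancel = solve 3 (λ o x y → o :* x := o :* x :- y :* con 1ℚ :+ y) refl
      where open +-*-Solver

    expand : ∀ t h l η c p → t * l * (h * c - η * p) ≡ t * h * (l * c) - (t * p) * (l * η)
    expand = solve 6 (λ t h l η c p → t :* l :* (h :* c :- η :* p) := t :* h :* (l :* c) :- (t :* p) :* (l :* η)) refl
      where open +-*-Solver

  -- A positive ε has numerator at least 1, so it is at least the reciprocal of its denominator.
  below-multiple : ∀ ε → 0ℚ < ε → ∀ {x y} → ↧ₙ ε ℕ.* x ℕ.≤ y → fromℕ x ≤ ε * fromℕ y
  below-multiple (mkℚ (+ zero)   d-1 c) (*<* (ℤ.+<+ ()))
  below-multiple (mkℚ -[1+ a ]   d-1 c) (*<* ())
  below-multiple ε@(mkℚ +[1+ a ] d-1 c) _ {x} {y} dx≤y = *-cancelˡ-≤-pos d {{fromℕ-positive (suc d-1)}} (begin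
    d * fromℕ x             ≡⟨ fromℕ-* (suc d-1) x ⟩
    fromℕ (suc d-1 ℕ.* x)   ≤⟨ fromℕ-mono-≤ (ℕ.≤-trans dx≤y (ℕ.m≤n*m y (suc a))) ⟩
    fromℕ (suc a ℕ.* y)     ≡⟨ fromℕ-* (suc a) y ⟨
    fromℕ (suc a) * fromℕ y ≡⟨ cong (_* fromℕ y) dε≡a ⟨
    d * ε * fromℕ y         ≡⟨ *-assoc d ε (fromℕ y) ⟩
    d * (ε * fromℕ y)       ∎)
    where
    open ≤-Reasoning
    d : ℚ
    d = fromℕ (suc d-1)
    dε≡a : d * ε ≡ fromℕ (suc a)
    dε≡a = trans (cong (_* ε) (fromℕ≡mkℚ (suc d-1))) (fromℚᵘ-cong {mkℚᵘ (+ suc d-1 ℤ.* + suc a) (d-1 ℕ.+ 0)} {mkℚᵘ (+ suc a) 0} (*≡*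
      (trans (ℤ.*-identityʳ (+ suc d-1 ℤ.* + suc a)) (trans (ℤ.*-comm (+ suc d-1) (+ suc a))
        (cong (λ n → + suc a ℤ.* + suc n) (sym (ℕ.+-identityʳ d-1)))))))

open import Data.Fin.Subset using (Subset)
open import Data.Nat using (ℕ; suc; _^_) renaming (_≤_ to _≤ℕ_; _*_ to _*ℕ_)
open import Data.Nat.Combinatorics using (_C_)
open import Data.Product using (_×_; _,_; ∃-syntax)
open import Data.Rational using (ℚ; 0ℚ; ½; _<_; _≤_; _*_; _-_; ↧ₙ_)
open import Relation.Nullary using (¬_)
open Rationals

theorem3p3 :
  ∀ (k : ℕ) → 1 ≤ℕ k →
  ∀ (ε : ℚ) → 0ℚ < ε →
  ∃[ η ] (0ℚ < η × (∃[ N ] (∀ (n : ℕ) → N ≤ℕ n →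
    ∀ (H : Hypergraph (2 *ℕ k) n) →
    ¬ CopyOf𝒞₃ k H →
    ½ * fromℕ (n C (2 *ℕ k)) - η * fromℕ (n ^ (2 *ℕ k)) < fromℕ (e H) →
    ∃[ V₁ ] ∃[ V₂ ] (IsPartition V₁ V₂ ×
      fromℕ (#incorrect V₁ V₂ H) ≤ ε * fromℕ (n ^ (2 *ℕ k))))))
-- Both η and the threshold depend on ε only through its denominator d: it suffices that d times the
-- number of incorrect sets is at most n^(2k).
theorem3p3 (suc m) _ ε 0<ε = recip scale , recip-positive scale , threshold , λ n N≤n H free dense →
  let V₁ , V₂ , part , few = few-incorrect-scaled N≤n H free
        (clear-denominators scale (n C r) (n ^ r) (e H) dense)
  in V₁ , V₂ , part , below-multiple ε 0<ε few
  where
  open Counting.Scaled m (↧ₙ ε)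
  instance
    _ = scale≢0
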